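{- Let $a, b \in \mathbb{N}$ be positive integers with $a + b > 4$, and let $x$ be a real number with $x > 1.8$. Then $$P_a(x)\, P_b(x) > P_{a+b}(x).$$
   Context: $\mathbb{N} = \{1,2,3,\ldots\}$. For a positive integer $k$, $\sigma(k) := \sum_{d \mid k} d$ is the sum of the positive divisors of $k$. The D'Arcais polynomials (also called Nekrasov--Okounkov polynomials) $P_n(x)$, $n \geq 0$, are defined recursively by $P_0(x) = 1$ and, for $n \geq 1$, $$P_n(x) := \frac{x}{n} \sum_{k=1}^{n} \sigma(k)\, P_{n-k}(x).$$ -}

module Defs where

open import Algebra.Bundles using (CommutativeMonoid)
import Algebra.Properties.CommutativeSemigroup as CommutativeSemigroupProperties
open import Data.Fin.Base as Fin using (Fin; toℕ)
import Data.Integer.Base as ℤ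
open import Data.List.Base using (applyUpTo; filter)
open import Data.Nat.Base as ℕ using (ℕ; zero; suc; _∸_; _⊔_)
open import Data.Nat.Divisibility using (_∣?_)
open import Data.Nat.ListAction using (sum)
import Data.Nat.Properties as ℕₚ
open import Data.Product.Base using (∃; _×_; _,_; proj₁; proj₂)
open import Data.Rational.Base
  using (ℚ; 0ℚ; 1ℚ; ½; _/_; _+_; _*_; _-_; -_; ∣_∣; _≤_; _<_; 1/_;
         Positive; NonZero; positive)
import Data.Rational.Properties as ℚₚ
open import Data.Vec.Base using (Vec; []; _∷_; head; lookup)
open import Data.Vec.Functional using (foldr)
open import Relation.Binary.PropositionalEquality
  using (_≡_; refl; sym; trans; cong; cong₂; subst; module ≡-Reasoning)

-- The real numbers, as Cauchy sequences of rationals.  Two sequences whose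
-- difference tends to 0 denote the same real; _<ℝ_ below does not
-- distinguish between them, so no quotient is taken.

IsCauchy : (ℕ → ℚ) → Set
IsCauchy s = ∀ ε → 0ℚ < ε →
  ∃ λ N → ∀ m n → N ℕ.≤ m → N ℕ.≤ n → ∣ s m - s n ∣ < ε

record ℝ : Set where
  no-eta-equality
  field
    seq    : ℕ → ℚ
    cauchy : IsCauchy seq

open ℝ public

infix  4 _<ℝ_ _>ℝ_
infixl 6 _+ℝ_
infixl 7 _*ℝ_

-- The gap ε is uniform in n; termwise strict inequality would only give
-- x ≤ y in the limit.
_<ℝ_ : ℝ → ℝ → Set
x <ℝ y = ∃ λ ε → 0ℚ < ε × ∃ λ N → ∀ n → N ℕ.≤ n → seq x n + ε ≤ seq y n

_>ℝ_ : ℝ → ℝ → Set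
x >ℝ y = y <ℝ x

fromℚ : ℚ → ℝ
fromℚ q .seq    _     = q
fromℚ q .cauchy ε 0<ε = 0 , λ _ _ _ _ →
  subst (_< ε) (sym (cong ∣_∣ (ℚₚ.+-inverseʳ q))) 0<ε

private
  module ℚ+ = CommutativeSemigroupProperties
    (CommutativeMonoid.commutativeSemigroup ℚₚ.+-0-commutativeMonoid)

  sub-interchange : ∀ a b c d → (a + b) - (c + d) ≡ (a - c) + (b - d)
  sub-interchange a b c d = trans
    (cong (a + b +_) (ℚₚ.neg-distrib-+ c d))
    (ℚ+.interchange a b (- c) (- d))

  sub-add : ∀ a b c → (a - b) + (b - c) ≡ a - c
  sub-add a b c = begin
    (a - b) + (b - c)      ≡⟨ ℚₚ.+-assoc a (- b) (b - c) ⟩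
    a + (- b + (b - c))    ≡⟨ cong (a +_) (ℚₚ.+-assoc (- b) b (- c)) ⟨
    a + ((- b + b) - c)    ≡⟨ cong (λ z → a + (z - c)) (ℚₚ.+-inverseˡ b) ⟩
    a + (0ℚ - c)           ≡⟨ cong (a +_) (ℚₚ.+-identityˡ (- c)) ⟩
    a - c                  ∎
    where open ≡-Reasoning

  sub-cancel : ∀ a b → (a - b) + b ≡ a
  sub-cancel a b = begin
    (a - b) + b      ≡⟨ ℚₚ.+-assoc a (- b) b ⟩
    a + (- b + b)    ≡⟨ cong (a +_) (ℚₚ.+-inverseˡ b) ⟩
    a + 0ℚ           ≡⟨ ℚₚ.+-identityʳ a ⟩
    a                ∎
    where open ≡-Reasoning

  *-distribˡ-sub : ∀ a b c → a * (b - c) ≡ a * b - a * c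
  *-distribˡ-sub a b c = trans
    (ℚₚ.*-distribˡ-+ a b (- c))
    (cong (a * b +_) (sym (ℚₚ.neg-distribʳ-* a c)))

  telescope : ∀ a b c d → a * b - c * d ≡ a * (b - d) + d * (a - c)
  telescope a b c d = begin
    a * b - c * d                        ≡⟨ sub-add (a * b) (a * d) (c * d) ⟨
    (a * b - a * d) + (a * d - c * d)    ≡⟨ cong₂ (λ y z → (a * b - a * d) + (y - z))
                                             (ℚₚ.*-comm a d) (ℚₚ.*-comm c d) ⟩
    (a * b - a * d) + (d * a - d * c)    ≡⟨ cong₂ _+_ (*-distribˡ-sub a b d) (*-distribˡ-sub d a c) ⟨
    a * (b - d) + d * (a - c)            ∎
    where open ≡-Reasoning

  half+half : ∀ ε → ε * ½ + ε * ½ ≡ ε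
  half+half ε = trans (sym (ℚₚ.*-distribˡ-+ ε ½ ½)) (ℚₚ.*-identityʳ ε)

  half-pos : ∀ {ε} → 0ℚ < ε → 0ℚ < ε * ½
  half-pos {ε} 0<ε = subst (_< ε * ½) (ℚₚ.*-zeroˡ ½) (ℚₚ.*-monoˡ-<-pos ½ 0<ε)

  +-cauchy : ∀ s t → IsCauchy s → IsCauchy t → IsCauchy (λ n → s n + t n)
  +-cauchy s t cs ct ε 0<ε with cs (ε * ½) (half-pos 0<ε) | ct (ε * ½) (half-pos 0<ε)
  ... | M , hs | N , ht = M ⊔ N , λ m n p q → begin-strict
      ∣ (s m + t m) - (s n + t n) ∣   ≡⟨ cong ∣_∣ (sub-interchange (s m) (t m) (s n) (t n)) ⟩
      ∣ (s m - s n) + (t m - t n) ∣   ≤⟨ ℚₚ.∣p+q∣≤∣p∣+∣q∣ (s m - s n) (t m - t n) ⟩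
      ∣ s m - s n ∣ + ∣ t m - t n ∣   <⟨ ℚₚ.+-mono-<
          (hs m n (ℕₚ.m⊔n≤o⇒m≤o M N p) (ℕₚ.m⊔n≤o⇒m≤o M N q))
          (ht m n (ℕₚ.m⊔n≤o⇒n≤o M N p) (ℕₚ.m⊔n≤o⇒n≤o M N q)) ⟩
      ε * ½ + ε * ½                   ≡⟨ half+half ε ⟩
      ε                               ∎
    where
    open ℚₚ.≤-Reasoning

  eventually-bounded : ∀ s → IsCauchy s →
    ∃ λ B → 0ℚ < B × ∃ λ N → ∀ n → N ℕ.≤ n → ∣ s n ∣ ≤ B
  eventually-bounded s cs with cs 1ℚ (ℚₚ.positive⁻¹ 1ℚ)
  ... | N , h = 1ℚ + ∣ s N ∣ , 0<B , N , λ n N≤n → begin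
      ∣ s n ∣                   ≡⟨ cong ∣_∣ (sub-cancel (s n) (s N)) ⟨
      ∣ (s n - s N) + s N ∣     ≤⟨ ℚₚ.∣p+q∣≤∣p∣+∣q∣ (s n - s N) (s N) ⟩
      ∣ s n - s N ∣ + ∣ s N ∣   ≤⟨ ℚₚ.+-monoˡ-≤ ∣ s N ∣ (ℚₚ.<⇒≤ (h n N N≤n ℕₚ.≤-refl)) ⟩
      1ℚ + ∣ s N ∣              ∎
    where
    open ℚₚ.≤-Reasoning
    0<B : 0ℚ < 1ℚ + ∣ s N ∣
    0<B = ℚₚ.+-mono-<-≤ (ℚₚ.positive⁻¹ 1ℚ) (ℚₚ.0≤∣p∣ (s N))

  *-cauchy : ∀ s t → IsCauchy s → IsCauchy t → IsCauchy (λ n → s n * t n)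
  *-cauchy s t cs ct ε 0<ε
    with eventually-bounded s cs | eventually-bounded t ct
  ... | B , 0<B , M , hB | C , 0<C , N , hC = K , close
    where
    open ℚₚ.≤-Reasoning
    D : ℚ
    D = B + C
    instance
      B-pos : Positive B
      B-pos = positive 0<B
      C-pos : Positive C
      C-pos = positive 0<C
      D-pos : Positive D
      D-pos = positive (ℚₚ.+-mono-< 0<B 0<C)
      D≢0 : NonZero D
      D≢0 = ℚₚ.pos⇒nonZero D
      1/D-pos : Positive (1/ D)
      1/D-pos = ℚₚ.1/pos⇒pos D
    δ : ℚ
    δ = ε * 1/ D
    0<δ : 0ℚ < δ
    0<δ = subst (_< δ) (ℚₚ.*-zeroˡ (1/ D)) (ℚₚ.*-monoˡ-<-pos (1/ D) 0<ε)
    K₁ K₂ K : ℕ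
    K₁ = proj₁ (cs δ 0<δ)
    K₂ = proj₁ (ct δ 0<δ)
    K  = (M ⊔ N) ⊔ (K₁ ⊔ K₂)
    bound : ∀ {b p q} .{{_ : Positive b}} → ∣ p ∣ ≤ b → ∣ q ∣ < δ → ∣ p * q ∣ < b * δ
    bound {b} {p} {q} p≤b q<δ = begin-strict
      ∣ p * q ∣       ≡⟨ ℚₚ.∣p*q∣≡∣p∣*∣q∣ p q ⟩
      ∣ p ∣ * ∣ q ∣   ≤⟨ ℚₚ.*-monoʳ-≤-nonNeg ∣ q ∣ {{ℚₚ.∣-∣-nonNeg q}} p≤b ⟩
      b * ∣ q ∣       <⟨ ℚₚ.*-monoʳ-<-pos b q<δ ⟩
      b * δ           ∎
    collect : B * δ + C * δ ≡ ε
    collect = begin-equality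
      B * δ + C * δ      ≡⟨ sym (ℚₚ.*-distribʳ-+ δ B C) ⟩
      D * (ε * 1/ D)     ≡⟨ ℚₚ.*-comm D δ ⟩
      (ε * 1/ D) * D     ≡⟨ ℚₚ.*-assoc ε (1/ D) D ⟩
      ε * (1/ D * D)     ≡⟨ cong (ε *_) (ℚₚ.*-inverseˡ D) ⟩
      ε * 1ℚ             ≡⟨ ℚₚ.*-identityʳ ε ⟩
      ε                  ∎
    close : ∀ m n → K ℕ.≤ m → K ℕ.≤ n → ∣ s m * t m - s n * t n ∣ < ε
    close m n p q = begin-strict
      ∣ s m * t m - s n * t n ∣
        ≡⟨ cong ∣_∣ (telescope (s m) (t m) (s n) (t n)) ⟩
      ∣ s m * (t m - t n) + t n * (s m - s n) ∣
        ≤⟨ ℚₚ.∣p+q∣≤∣p∣+∣q∣ (s m * (t m - t n)) (t n * (s m - s n)) ⟩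
      ∣ s m * (t m - t n) ∣ + ∣ t n * (s m - s n) ∣
        <⟨ ℚₚ.+-mono-<
             (bound {B} {s m} {t m - t n} (hB m (M≤ p)) (proj₂ (ct δ 0<δ) m n (K₂≤ p) (K₂≤ q)))
             (bound {C} {t n} {s m - s n} (hC n (N≤ q)) (proj₂ (cs δ 0<δ) m n (K₁≤ p) (K₁≤ q))) ⟩
      B * δ + C * δ
        ≡⟨ collect ⟩
      ε ∎
      where
      M≤ : ∀ {k} → K ℕ.≤ k → M ℕ.≤ k
      M≤ r = ℕₚ.m⊔n≤o⇒m≤o M N (ℕₚ.m⊔n≤o⇒m≤o (M ⊔ N) (K₁ ⊔ K₂) r)
      N≤ : ∀ {k} → K ℕ.≤ k → N ℕ.≤ k
      N≤ r = ℕₚ.m⊔n≤o⇒n≤o M N (ℕₚ.m⊔n≤o⇒m≤o (M ⊔ N) (K₁ ⊔ K₂) r)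
      K₁≤ : ∀ {k} → K ℕ.≤ k → K₁ ℕ.≤ k
      K₁≤ r = ℕₚ.m⊔n≤o⇒m≤o K₁ K₂ (ℕₚ.m⊔n≤o⇒n≤o (M ⊔ N) (K₁ ⊔ K₂) r)
      K₂≤ : ∀ {k} → K ℕ.≤ k → K₂ ℕ.≤ k
      K₂≤ r = ℕₚ.m⊔n≤o⇒n≤o K₁ K₂ (ℕₚ.m⊔n≤o⇒n≤o (M ⊔ N) (K₁ ⊔ K₂) r)

_+ℝ_ : ℝ → ℝ → ℝ
(x +ℝ y) .seq n  = seq x n + seq y n
(x +ℝ y) .cauchy = +-cauchy (seq x) (seq y) (cauchy x) (cauchy y)

_*ℝ_ : ℝ → ℝ → ℝ
(x *ℝ y) .seq n  = seq x n * seq y n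
(x *ℝ y) .cauchy = *-cauchy (seq x) (seq y) (cauchy x) (cauchy y)

∑ : ∀ {n} → (Fin n → ℝ) → ℝ
∑ = foldr _+ℝ_ (fromℚ 0ℚ)

σ : ℕ → ℕ
σ k = sum (filter (_∣? k) (applyUpTo suc k))

-- One step of the recursion: from P_n(x), …, P_0(x), in this order, to
-- P_{n+1}(x).  The index i corresponds to k = i + 1 in
-- P_{n+1}(x) = x/(n+1) · ∑_{k=1}^{n+1} σ(k) P_{n+1-k}(x).
step : ∀ {n} → ℝ → (Fin (suc n) → ℝ) → ℝ
step {n} x ps =
  fromℚ (ℤ.+ 1 / suc n) *ℝ x *ℝ ∑ λ i → fromℚ (ℤ.+ σ (suc (toℕ i)) / 1) *ℝ ps i

table : ∀ n → ℝ → Vec ℝ (suc n)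
table zero    x = fromℚ 1ℚ ∷ []
table (suc n) x = step x (lookup (table n x)) ∷ table n x

-- The value at x of the n-th D'Arcais polynomial; P-zero and P-suc are its
-- defining recursion.
P : ℕ → ℝ → ℝ
P n x = head (table n x)

P-zero : ∀ x → P 0 x ≡ fromℚ 1ℚ
P-zero x = refl

private
  lookup-table : ∀ n x (i : Fin (suc n)) → lookup (table n x) i ≡ P (n ∸ toℕ i) x
  lookup-table zero    x Fin.zero    = refl
  lookup-table (suc n) x Fin.zero    = refl
  lookup-table (suc n) x (Fin.suc i) = lookup-table n x i

  ∑-cong : ∀ {n} {f g : Fin n → ℝ} → (∀ i → f i ≡ g i) → ∑ f ≡ ∑ g
  ∑-cong {zero}  h = refl
  ∑-cong {suc n} h = cong₂ _+ℝ_ (h Fin.zero) (∑-cong λ i → h (Fin.suc i))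

P-suc : ∀ n x → P (suc n) x ≡
  fromℚ (ℤ.+ 1 / suc n) *ℝ x *ℝ
    ∑ λ (i : Fin (suc n)) → fromℚ (ℤ.+ σ (suc (toℕ i)) / 1) *ℝ P (suc n ∸ suc (toℕ i)) x
P-suc n x = cong (fromℚ (ℤ.+ 1 / suc n) *ℝ x *ℝ_) (∑-cong λ i →
  cong (fromℚ (ℤ.+ σ (suc (toℕ i)) / 1) *ℝ_) (lookup-table n x i))

{-# OPTIONS --safe #-}
module Submission where

-- Write D(a, b) = P_a P_b - P_{a+b}.  Splitting the convolution for P_{a+b} at k = a gives
--   (a+b) D(a, b) = x ( ∑_{k≤a} σ(k) D(a-k, b) + ∑_{k≤b} P_{b-k} (σ(k) P_a - σ(a+k)) ),
-- and one argues by induction on a + b, for b ≤ a.  The second sum is large because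
-- 8 σ(n) ≤ n (n + 10), while 10 P_n is at least 10 n² for n ≥ 6.  The only negative terms in
-- the first sum are D(1, b) ≥ -9/8 for b ≤ 3, D(2, 1) ≥ -1/2 and D(3, 1) ≥ -9/8, and the
-- second sum absorbs them.  In fact (a+b) D(a, b) ≥ 1 for every rational x ≥ 9/5, which gives
-- a gap uniform along a Cauchy sequence.

open import Defs

-- The order `b ≤ a` orients the splitting: in the second sum k ≤ b ≤ a, hence a + k ≤ k(a+1) and a
-- + k + 10 ≤ 2a + 10. The quadratic bound for σ(a+k) therefore carries a factor k, to be compared
-- with P_a σ(k) ≥ k P_a, and what remains is a lower bound for P_a alone. Since the recursion has
-- nonnegative coefficients, a lower bound valid at x = 9/5 passes to every larger x. The induction
-- consumes only D ≥ 0 for smaller pairs. The 1 is produced afresh in each step by the term k = 1 of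
-- the second sum, P_{b-1} (P_a - σ(a+1)) ≥ 1. For b ≥ 2 the one term of the first sum that may be
-- negative is σ(a-1) D(1, b), and the term k = 2 of the second sum pays for it. For b = 1 the
-- second sum has a single term, which must supply the 1 and also pay for D(3, 1), D(2, 1) and D(1,
-- 1); hence the separate case with its tighter numerical estimate.

module Arithmetic where

  open import Data.Nat.Base using (ℕ; zero; suc; _+_; _*_; _∸_; _≤_; _<_; z≤n; s≤s)
  import Data.Nat.Properties as ℕₚ
  open import Data.Nat.Divisibility using (_∣_; _∣?_; divides; ∣-refl)
  open import Data.Nat.ListAction using (sum)
  open import Data.Nat.ListAction.Properties using (sum-++)
  import Data.Nat.Solver
  open import Data.List.Base using (_++_; filter; applyUpTo; [_]; _∷ʳ_)
  open import Data.List.Properties using (filter-++; filter-accept; filter-reject; applyUpTo-∷ʳ)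
  open import Data.Empty using (⊥-elim)
  open import Relation.Nullary using (yes; no; ¬_)
  open import Relation.Binary.PropositionalEquality
    using (_≡_; refl; sym; trans; cong; cong₂; subst; module ≡-Reasoning)

  module ℕ-Solver = Data.Nat.Solver.+-*-Solver

  -- Upper bound for the divisor sum

  ≤-from-+ : ∀ {m n} r → m + r ≡ n → m ≤ n
  ≤-from-+ r eq = ℕₚ.m+n≤o⇒m≤o _ {r} (ℕₚ.≤-reflexive eq)

  -- The divisor sum of `n` cut off at `l`, so that induction can run on the cut-off while `n` stays
  -- fixed; `σ≤ n n` is `σ n`.
  σ≤ : ℕ → ℕ → ℕ
  σ≤ n l = sum (filter (_∣? n) (applyUpTo suc l))

  σ≤-snoc : ∀ n l → σ≤ n (suc l) ≡ σ≤ n l + sum (filter (_∣? n) [ suc l ])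
  σ≤-snoc n l = begin
    sum (filter (_∣? n) (applyUpTo suc (suc l)))
      ≡⟨ cong (λ ds → sum (filter (_∣? n) ds)) (applyUpTo-∷ʳ suc l) ⟨
    sum (filter (_∣? n) (applyUpTo suc l ∷ʳ suc l))
      ≡⟨ cong sum (filter-++ (_∣? n) (applyUpTo suc l) [ suc l ]) ⟩
    sum (filter (_∣? n) (applyUpTo suc l) ++ filter (_∣? n) [ suc l ])
      ≡⟨ sum-++ (filter (_∣? n) (applyUpTo suc l)) _ ⟩
    σ≤ n l + sum (filter (_∣? n) [ suc l ]) ∎
    where open ≡-Reasoning

  σ≤-∣ : ∀ n l → suc l ∣ n → σ≤ n (suc l) ≡ σ≤ n l + suc l
  σ≤-∣ n l l∣n = trans (σ≤-snoc n l) (cong (σ≤ n l +_)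
    (trans (cong sum (filter-accept (_∣? n) l∣n)) (ℕₚ.+-identityʳ (suc l))))

  σ≤-∤ : ∀ n l → ¬ suc l ∣ n → σ≤ n (suc l) ≡ σ≤ n l
  σ≤-∤ n l l∤n = trans (σ≤-snoc n l) (trans (cong (σ≤ n l +_)
    (cong sum (filter-reject (_∣? n) l∤n))) (ℕₚ.+-identityʳ (σ≤ n l)))

  σ≤-triangular : ∀ n l → 2 * σ≤ n l ≤ l * suc l
  σ≤-triangular n zero    = z≤n
  σ≤-triangular n (suc l) with suc l ∣? n
  ... | yes l∣n = begin
    2 * σ≤ n (suc l)       ≡⟨ cong (2 *_) (σ≤-∣ n l l∣n) ⟩
    2 * (σ≤ n l + suc l)   ≡⟨ ℕₚ.*-distribˡ-+ 2 (σ≤ n l) (suc l) ⟩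
    2 * σ≤ n l + 2 * suc l ≤⟨ ℕₚ.+-monoˡ-≤ (2 * suc l) (σ≤-triangular n l) ⟩
    l * suc l + 2 * suc l  ≡⟨ solve 1 (λ l → l :* (con 1 :+ l) :+ con 2 :* (con 1 :+ l) := (con 1 :+ l) :* (con 2 :+ l)) refl l ⟩
    suc l * suc (suc l)    ∎
    where
    open ℕₚ.≤-Reasoning
    open ℕ-Solver
  ... | no  l∤n = begin
    2 * σ≤ n (suc l)       ≡⟨ cong (2 *_) (σ≤-∤ n l l∤n) ⟩
    2 * σ≤ n l             ≤⟨ σ≤-triangular n l ⟩
    l * suc l              ≤⟨ ℕₚ.*-mono-≤ (ℕₚ.n≤1+n l) (ℕₚ.n≤1+n (suc l)) ⟩
    suc l * suc (suc l)    ∎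
    where open ℕₚ.≤-Reasoning

  proper-divisor≤half : ∀ {d n} → d ∣ n → d < n → 2 * d ≤ n
  proper-divisor≤half (divides zero          refl) ()
  proper-divisor≤half {d} (divides (suc zero) refl) d<n =
    ⊥-elim (ℕₚ.<-irrefl (sym (ℕₚ.*-identityˡ d)) d<n)
  proper-divisor≤half {d} (divides (suc (suc q)) refl) _ =
    ℕₚ.*-monoˡ-≤ d (s≤s (s≤s (z≤n {q})))

  -- Descend from `l` to the largest divisor d ≤ l of `n`. It is proper, so 2d ≤ n, and the divisors
  -- up to d sum to at most d(d+1)/2 ≤ n(n+2)/8. Adding the divisor n itself then gives n(n+10)/8.
  σ≤-proper : ∀ n l → l < n → 8 * σ≤ n l ≤ n * (n + 2)
  σ≤-proper n zero    _   = z≤n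
  σ≤-proper n (suc l) l<n with suc l ∣? n
  ... | no  l∤n = begin
    8 * σ≤ n (suc l)  ≡⟨ cong (8 *_) (σ≤-∤ n l l∤n) ⟩
    8 * σ≤ n l        ≤⟨ σ≤-proper n l (ℕₚ.<-trans (ℕₚ.n<1+n l) l<n) ⟩
    n * (n + 2)       ∎
    where open ℕₚ.≤-Reasoning
  ... | yes l∣n = begin
    8 * σ≤ n (suc l)                      ≡⟨ ℕₚ.*-assoc 4 2 (σ≤ n (suc l)) ⟩
    4 * (2 * σ≤ n (suc l))                ≤⟨ ℕₚ.*-monoʳ-≤ 4 (σ≤-triangular n (suc l)) ⟩
    4 * (suc l * suc (suc l))             ≡⟨ solve 1 (λ l → con 4 :* ((con 1 :+ l) :* (con 2 :+ l)) := (con 2 :* (con 1 :+ l)) :* (con 2 :* (con 1 :+ l) :+ con 2)) refl l ⟩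
    (2 * suc l) * (2 * suc l + 2)         ≤⟨ ℕₚ.*-mono-≤ half (ℕₚ.+-monoˡ-≤ 2 half) ⟩
    n * (n + 2)                           ∎
    where
    open ℕₚ.≤-Reasoning
    open ℕ-Solver
    half : 2 * suc l ≤ n
    half = proper-divisor≤half l∣n l<n

  σ-split : ∀ m → σ (suc m) ≡ σ≤ (suc m) m + suc m
  σ-split m = σ≤-∣ (suc m) m ∣-refl

  n≤σ[n] : ∀ n → n ≤ σ n
  n≤σ[n] zero    = z≤n
  n≤σ[n] (suc m) = subst (suc m ≤_) (sym (σ-split m)) (ℕₚ.m≤n+m (suc m) _)

  8σ[n]≤n[n+10] : ∀ n → 8 * σ n ≤ n * (n + 10)
  8σ[n]≤n[n+10] zero    = z≤n
  8σ[n]≤n[n+10] (suc m) = begin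
    8 * σ (suc m)                    ≡⟨ cong (8 *_) (σ-split m) ⟩
    8 * (σ≤ (suc m) m + suc m)       ≡⟨ ℕₚ.*-distribˡ-+ 8 (σ≤ (suc m) m) (suc m) ⟩
    8 * σ≤ (suc m) m + 8 * suc m     ≤⟨ ℕₚ.+-monoˡ-≤ (8 * suc m) (σ≤-proper (suc m) m ℕₚ.≤-refl) ⟩
    suc m * (suc m + 2) + 8 * suc m  ≡⟨ solve 1 (λ n → n :* (n :+ con 2) :+ con 8 :* n := n :* (n :+ con 10)) refl (suc m) ⟩
    suc m * (suc m + 10)             ∎
    where
    open ℕₚ.≤-Reasoning
    open ℕ-Solver

  -- A lower bound for 10 P_n(x), x ≥ 9/5.  Its values for n ≤ 5 come from running the
  -- recursion at x = 9/5, rounding down at each step.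
  G : ℕ → ℕ
  G 0 = 10
  G 1 = 18
  G 2 = 43
  G 3 = 82
  G 4 = 158
  G 5 = 274
  G n@(suc (suc (suc (suc (suc (suc _)))))) = 10 * (n * n)

  -- Convolution sums of `G`

  Σℕ : ℕ → (ℕ → ℕ) → ℕ
  Σℕ zero    f = 0
  Σℕ (suc n) f = f 0 + Σℕ n (λ j → f (suc j))

  Σℕ-mono : ∀ n {f g : ℕ → ℕ} → (∀ j → f j ≤ g j) → Σℕ n f ≤ Σℕ n g
  Σℕ-mono zero    f≤g = z≤n
  Σℕ-mono (suc n) f≤g = ℕₚ.+-mono-≤ (f≤g 0) (Σℕ-mono n (λ j → f≤g (suc j)))

  Σℕ-add : ∀ n {f g h : ℕ → ℕ} → (∀ j → h j ≡ f j + g j) → Σℕ n h ≡ Σℕ n f + Σℕ n g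
  Σℕ-add zero    eq = refl
  Σℕ-add (suc n) {f} {g} {h} eq = trans
    (cong₂ _+_ (eq 0) (Σℕ-add n (λ j → eq (suc j))))
    (solve 4 (λ a b c d → (a :+ b) :+ (c :+ d) := (a :+ c) :+ (b :+ d)) refl (f 0) (g 0) _ _)
    where open ℕ-Solver

  -- `ΣG n` is G(0) + ... + G(n-1). `ΣΣG n` convolves `G` with k ↦ k, so it is the iterated sum
  -- ΣG(1) + ... + ΣG(n).
  ΣG ΣΣG : ℕ → ℕ
  ΣG  n = Σℕ n (λ j → G (n ∸ suc j))
  ΣΣG n = Σℕ n (λ j → suc j * G (n ∸ suc j))

  ΣΣG-suc : ∀ n → ΣΣG (suc n) ≡ ΣG (suc n) + ΣΣG n
  ΣΣG-suc n = trans
    (cong₂ _+_ (ℕₚ.*-identityˡ (G n)) (Σℕ-add n {λ j → G (n ∸ suc j)} {λ j → suc j * G (n ∸ suc j)} (λ _ → refl)))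
    (sym (ℕₚ.+-assoc (G n) _ _))

  -- With n = 7 + m the left side is 30 (0² + 1² + ... + (n-1)²). At n = 7 the deficits of `G`
  -- against 10 i² at i = 3, 4 are outweighed by its excess at i = 0, 1, 2, 5; from there on `G` is
  -- exactly quadratic.
  ΣG-bound : ∀ m → 5 * ((6 + m) * (7 + m) * (13 + 2 * m)) ≤ 3 * ΣG (7 + m)
  ΣG-bound zero    = ℕₚ.≤ᵇ⇒≤ _ _ _
  ΣG-bound (suc m) = begin
    5 * ((7 + m) * (8 + m) * (13 + 2 * suc m))
      ≡⟨ solve 1 (λ m → con 5 :* ((con 7 :+ m) :* (con 8 :+ m) :* (con 13 :+ con 2 :* (con 1 :+ m)))
           := con 3 :* (con 10 :* ((con 7 :+ m) :* (con 7 :+ m))) :+ con 5 :* ((con 6 :+ m) :* (con 7 :+ m) :* (con 13 :+ con 2 :* m))) refl m ⟩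
    3 * G (7 + m) + 5 * ((6 + m) * (7 + m) * (13 + 2 * m))
      ≤⟨ ℕₚ.+-monoʳ-≤ (3 * G (7 + m)) (ΣG-bound m) ⟩
    3 * G (7 + m) + 3 * ΣG (7 + m)
      ≡⟨ ℕₚ.*-distribˡ-+ 3 (G (7 + m)) (ΣG (7 + m)) ⟨
    3 * ΣG (8 + m) ∎
    where
    open ℕₚ.≤-Reasoning
    open ℕ-Solver

  -- Summing squares twice gives n²(n²-1)/12, here with n = 7 + m. With this bound the subsolution
  -- inequality for 10 n² becomes 20 n ≤ 3 (n²-1), which first holds at n = 7.
  ΣΣG-bound : ∀ m → 5 * (((7 + m) * (7 + m)) * ((6 + m) * (8 + m))) ≤ 6 * ΣΣG (7 + m)
  ΣΣG-bound zero    = ℕₚ.≤ᵇ⇒≤ _ _ _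
  ΣΣG-bound (suc m) = begin
    5 * (((8 + m) * (8 + m)) * ((7 + m) * (9 + m)))
      ≡⟨ solve 1 (λ m → con 5 :* (((con 8 :+ m) :* (con 8 :+ m)) :* ((con 7 :+ m) :* (con 9 :+ m)))
           := con 2 :* (con 5 :* ((con 7 :+ m) :* (con 8 :+ m) :* (con 13 :+ con 2 :* (con 1 :+ m)))) :+ con 5 :* (((con 7 :+ m) :* (con 7 :+ m)) :* ((con 6 :+ m) :* (con 8 :+ m)))) refl m ⟩
    2 * (5 * ((7 + m) * (8 + m) * (13 + 2 * suc m))) + 5 * (((7 + m) * (7 + m)) * ((6 + m) * (8 + m)))
      ≤⟨ ℕₚ.+-mono-≤ (ℕₚ.*-monoʳ-≤ 2 (ΣG-bound (suc m))) (ΣΣG-bound m) ⟩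
    2 * (3 * ΣG (8 + m)) + 6 * ΣΣG (7 + m)
      ≡⟨ solve 2 (λ r t → con 2 :* (con 3 :* r) :+ con 6 :* t := con 6 :* (r :+ t)) refl (ΣG (8 + m)) (ΣΣG (7 + m)) ⟩
    6 * (ΣG (8 + m) + ΣΣG (7 + m))
      ≡⟨ cong (6 *_) (ΣΣG-suc (7 + m)) ⟨
    6 * ΣΣG (8 + m) ∎
    where
    open ℕₚ.≤-Reasoning
    open ℕ-Solver

  -- G is a subsolution of the recursion at x = 9/5; from n = 7 on, σ(k) ≥ k is enough.
  G-subsolution : ∀ n → 5 * (suc n * G (suc n)) ≤ 9 * Σℕ (suc n) (λ j → σ (suc j) * G (n ∸ j))
  G-subsolution 0 = ℕₚ.≤ᵇ⇒≤ _ _ _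
  G-subsolution 1 = ℕₚ.≤ᵇ⇒≤ _ _ _
  G-subsolution 2 = ℕₚ.≤ᵇ⇒≤ _ _ _
  G-subsolution 3 = ℕₚ.≤ᵇ⇒≤ _ _ _
  G-subsolution 4 = ℕₚ.≤ᵇ⇒≤ _ _ _
  G-subsolution 5 = ℕₚ.≤ᵇ⇒≤ _ _ _
  G-subsolution (suc (suc (suc (suc (suc (suc m)))))) = ℕₚ.*-cancelˡ-≤ 6 (begin
    6 * (5 * ((7 + m) * G (7 + m)))
      ≤⟨ ≤-from-+ (((7 + m) * (7 + m)) * (60 + 330 * m + 45 * (m * m))) (solve 1 (λ m →
           con 6 :* (con 5 :* ((con 7 :+ m) :* (con 10 :* ((con 7 :+ m) :* (con 7 :+ m)))))
             :+ ((con 7 :+ m) :* (con 7 :+ m)) :* (con 60 :+ con 330 :* m :+ con 45 :* (m :* m))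
           := con 9 :* (con 5 :* (((con 7 :+ m) :* (con 7 :+ m)) :* ((con 6 :+ m) :* (con 8 :+ m))))) refl m) ⟩
    9 * (5 * (((7 + m) * (7 + m)) * ((6 + m) * (8 + m))))
      ≤⟨ ℕₚ.*-monoʳ-≤ 9 (ΣΣG-bound m) ⟩
    9 * (6 * ΣΣG (7 + m))
      ≤⟨ ℕₚ.*-monoʳ-≤ 9 (ℕₚ.*-monoʳ-≤ 6 (Σℕ-mono (7 + m) (λ j → ℕₚ.*-monoˡ-≤ (G (6 + m ∸ j)) (n≤σ[n] (suc j))))) ⟩
    9 * (6 * Σℕ (7 + m) (λ j → σ (suc j) * G (6 + m ∸ j)))
      ≡⟨ solve 1 (λ t → con 9 :* (con 6 :* t) := con 6 :* (con 9 :* t)) refl (Σℕ (7 + m) (λ j → σ (suc j) * G (6 + m ∸ j))) ⟩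
    6 * (9 * Σℕ (7 + m) (λ j → σ (suc j) * G (6 + m ∸ j))) ∎)
    where
    open ℕₚ.≤-Reasoning
    open ℕ-Solver

  10≤G : ∀ n → 10 ≤ G n
  10≤G 0 = ℕₚ.≤ᵇ⇒≤ _ _ _
  10≤G 1 = ℕₚ.≤ᵇ⇒≤ _ _ _
  10≤G 2 = ℕₚ.≤ᵇ⇒≤ _ _ _
  10≤G 3 = ℕₚ.≤ᵇ⇒≤ _ _ _
  10≤G 4 = ℕₚ.≤ᵇ⇒≤ _ _ _
  10≤G 5 = ℕₚ.≤ᵇ⇒≤ _ _ _
  10≤G (suc (suc (suc (suc (suc (suc m)))))) = ℕₚ.m≤m*n 10 ((6 + m) * (6 + m))

  -- Comparison of σ with `G`

  G-quadratic : ∀ n → 6 ≤ n → G n ≡ 10 * (n * n)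
  G-quadratic _ (s≤s (s≤s (s≤s (s≤s (s≤s (s≤s _)))))) = refl

  -- This is what `σ-ratio` requires after its factor k is cancelled. It is nearly sharp at a = 3
  -- (320 against 328) and fails at a = 2.
  G-lower : ∀ a → 3 ≤ a → 5 * (suc a * (2 * a + 10)) ≤ 4 * G a
  G-lower 3 _ = ℕₚ.≤ᵇ⇒≤ _ _ _
  G-lower 4 _ = ℕₚ.≤ᵇ⇒≤ _ _ _
  G-lower 5 _ = ℕₚ.≤ᵇ⇒≤ _ _ _
  G-lower 0 ()
  G-lower 1 (s≤s ())
  G-lower 2 (s≤s (s≤s ()))
  G-lower (suc (suc (suc (suc (suc (suc m)))))) _ = ≤-from-+ (670 + 300 * m + 30 * (m * m)) (solve 1 (λ m →
    con 5 :* ((con 7 :+ m) :* (con 2 :* (con 6 :+ m) :+ con 10)) :+ (con 670 :+ con 300 :* m :+ con 30 :* (m :* m))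
      := con 4 :* (con 10 :* ((con 6 :+ m) :* (con 6 :+ m)))) refl m)
    where open ℕ-Solver

  -- With k = j + 1 ≤ a, the bound (a+k)(a+k+10) for 8 σ(a+k) is at most k(a+1)(2a+10), and k ≤
  -- σ(k).
  σ-ratio : ∀ a j → 3 ≤ a → j < a → 10 * σ (suc (a + j)) ≤ G a * σ (suc j)
  σ-ratio a j 3≤a j<a = ℕₚ.*-cancelˡ-≤ 8 (begin
    8 * (10 * σ N)
      ≡⟨ solve 1 (λ s → con 8 :* (con 10 :* s) := con 10 :* (con 8 :* s)) refl (σ N) ⟩
    10 * (8 * σ N)
      ≤⟨ ℕₚ.*-monoʳ-≤ 10 (8σ[n]≤n[n+10] N) ⟩
    10 * (N * (N + 10))
      ≤⟨ ℕₚ.*-monoʳ-≤ 10 (ℕₚ.*-mono-≤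
           (≤-from-+ (j * a) (solve 2 (λ a j → con 1 :+ (a :+ j) :+ j :* a := (con 1 :+ j) :* (con 1 :+ a)) refl a j))
           (ℕₚ.+-monoˡ-≤ 10 N≤2a)) ⟩
    10 * (suc j * suc a * (2 * a + 10))
      ≡⟨ solve 2 (λ a j → con 10 :* ((con 1 :+ j) :* (con 1 :+ a) :* (con 2 :* a :+ con 10))
           := (con 2 :* (con 1 :+ j)) :* (con 5 :* ((con 1 :+ a) :* (con 2 :* a :+ con 10)))) refl a j ⟩
    (2 * suc j) * (5 * (suc a * (2 * a + 10)))
      ≤⟨ ℕₚ.*-monoʳ-≤ (2 * suc j) (G-lower a 3≤a) ⟩
    (2 * suc j) * (4 * G a)
      ≡⟨ solve 2 (λ g j → (con 2 :* j) :* (con 4 :* g) := con 8 :* (g :* j)) refl (G a) (suc j) ⟩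
    8 * (G a * suc j)
      ≤⟨ ℕₚ.*-monoʳ-≤ 8 (ℕₚ.*-monoʳ-≤ (G a) (n≤σ[n] (suc j))) ⟩
    8 * (G a * σ (suc j)) ∎)
    where
    open ℕₚ.≤-Reasoning
    open ℕ-Solver
    N = suc (a + j)
    N≤2a : N ≤ 2 * a
    N≤2a = begin
      suc (a + j)  ≡⟨ ℕₚ.+-suc a j ⟨
      a + suc j    ≤⟨ ℕₚ.+-monoʳ-≤ a j<a ⟩
      a + a        ≡⟨ cong (a +_) (ℕₚ.+-identityʳ a) ⟨
      2 * a        ∎

  -- Yields P_a - σ(a+1) ≥ 1, the source of the 1 in the induction. The shape `suc m + 2` of `a`
  -- matches the cut of the first sum before its last two terms.
  σ-bound-k≡1 : ∀ m → let a = suc m + 2 in 10 * σ (suc (a + 0)) + 10 ≤ G a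
  σ-bound-k≡1 m = ℕₚ.*-cancelˡ-≤ 8 (begin
    8 * (10 * σ N + 10)
      ≡⟨ solve 1 (λ s → con 8 :* (con 10 :* s :+ con 10) := con 10 :* (con 8 :* s) :+ con 80) refl (σ N) ⟩
    10 * (8 * σ N) + 80
      ≤⟨ ℕₚ.+-monoˡ-≤ 80 (ℕₚ.*-monoʳ-≤ 10 (8σ[n]≤n[n+10] N)) ⟩
    10 * (N * (N + 10)) + 80
      ≤⟨ ≤-from-+ (60 * m + 10 * (m * m)) (solve 1 (λ m →
           let a = con 1 :+ m :+ con 2; n = con 1 :+ (a :+ con 0) in
           con 10 :* (n :* (n :+ con 10)) :+ con 80 :+ (con 60 :* m :+ con 10 :* (m :* m))
             := con 2 :* (con 5 :* ((con 1 :+ a) :* (con 2 :* a :+ con 10)))) refl m) ⟩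
    2 * (5 * (suc a * (2 * a + 10)))
      ≤⟨ ℕₚ.*-monoʳ-≤ 2 (G-lower a (s≤s (ℕₚ.m≤n+m 2 m))) ⟩
    2 * (4 * G a)
      ≡⟨ ℕₚ.*-assoc 2 4 (G a) ⟨
    8 * G a ∎)
    where
    open ℕₚ.≤-Reasoning
    open ℕ-Solver
    a = suc m + 2
    N = suc (a + 0)

  -- Here and in σ-bound-b≡1, the weights 90 and 40 are 80 times 9/8, which bounds -D(1, b) and
  -- -D(3, 1), and 1/2, which bounds -D(2, 1).
  σ-bound-k≡2 : ∀ m → let a = suc m + 2 in
    80 * σ (suc (a + 1)) + 90 * σ (suc (suc m + 0)) ≤ 24 * G a
  σ-bound-k≡2 m = ℕₚ.*-cancelˡ-≤ 4 (begin
    4 * (80 * σ N + 90 * σ M)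
      ≡⟨ solve 2 (λ s t → con 4 :* (con 80 :* s :+ con 90 :* t) := con 40 :* (con 8 :* s) :+ con 45 :* (con 8 :* t)) refl (σ N) (σ M) ⟩
    40 * (8 * σ N) + 45 * (8 * σ M)
      ≤⟨ ℕₚ.+-mono-≤ (ℕₚ.*-monoʳ-≤ 40 (8σ[n]≤n[n+10] N)) (ℕₚ.*-monoʳ-≤ 45 (8σ[n]≤n[n+10] M)) ⟩
    40 * (N * (N + 10)) + 45 * (M * (M + 10))
      ≤⟨ ≤-from-+ (3600 + 1450 * m + 155 * (m * m)) (solve 1 (λ m →
           let a = con 1 :+ m :+ con 2; n = con 1 :+ (a :+ con 1); k = con 1 :+ (con 1 :+ m :+ con 0) in
           con 40 :* (n :* (n :+ con 10)) :+ con 45 :* (k :* (k :+ con 10)) :+ (con 3600 :+ con 1450 :* m :+ con 155 :* (m :* m))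
             := con 24 :* (con 5 :* ((con 1 :+ a) :* (con 2 :* a :+ con 10)))) refl m) ⟩
    24 * (5 * (suc a * (2 * a + 10)))
      ≤⟨ ℕₚ.*-monoʳ-≤ 24 (G-lower a (s≤s (ℕₚ.m≤n+m 2 m))) ⟩
    24 * (4 * G a)
      ≡⟨ solve 1 (λ g → con 24 :* (con 4 :* g) := con 4 :* (con 24 :* g)) refl (G a) ⟩
    4 * (24 * G a) ∎)
    where
    open ℕₚ.≤-Reasoning
    open ℕ-Solver
    a = suc m + 2
    N = suc (a + 1)
    M = suc (suc m + 0)

  σ-bound-b≡1 : ∀ m → let a = m + 4 in
    80 * σ (suc (a + 0)) + 80 +
      (90 * σ (suc (m + 0)) + 40 * σ (suc (m + 1)) + 90 * σ (suc (m + 2))) ≤ 8 * G a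
  -- `G` is quadratic only from 6 on, so a = 4 and a = 5 are computed: 1130 against 1264 and 2100
  -- against 2192.
  σ-bound-b≡1 0 = ℕₚ.≤ᵇ⇒≤ _ _ _
  σ-bound-b≡1 1 = ℕₚ.≤ᵇ⇒≤ _ _ _
  σ-bound-b≡1 (suc (suc m)) = ℕₚ.*-cancelˡ-≤ 8 (begin
    8 * (80 * σ N + 80 + (90 * σ N₀ + 40 * σ N₁ + 90 * σ N₂))
      ≡⟨ solve 4 (λ s t u v → con 8 :* (con 80 :* s :+ con 80 :+ (con 90 :* t :+ con 40 :* u :+ con 90 :* v))
           := con 80 :* (con 8 :* s) :+ con 640 :+ (con 90 :* (con 8 :* t) :+ con 40 :* (con 8 :* u) :+ con 90 :* (con 8 :* v))) refl
           (σ N) (σ N₀) (σ N₁) (σ N₂) ⟩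
    80 * (8 * σ N) + 640 + (90 * (8 * σ N₀) + 40 * (8 * σ N₁) + 90 * (8 * σ N₂))
      ≤⟨ ℕₚ.+-mono-≤ (ℕₚ.+-monoˡ-≤ 640 (bound 80 N))
           (ℕₚ.+-mono-≤ (ℕₚ.+-mono-≤ (bound 90 N₀) (bound 40 N₁)) (bound 90 N₂)) ⟩
    80 * (N * (N + 10)) + 640 + (90 * (N₀ * (N₀ + 10)) + 40 * (N₁ * (N₁ + 10)) + 90 * (N₂ * (N₂ + 10)))
      ≤⟨ ≤-from-+ (380 + 1800 * m + 340 * (m * m)) (solve 1 (λ m →
           let a = con 2 :+ m :+ con 4; n = con 1 :+ (a :+ con 0)
               n₀ = con 1 :+ (con 2 :+ m :+ con 0); n₁ = con 1 :+ (con 2 :+ m :+ con 1); n₂ = con 1 :+ (con 2 :+ m :+ con 2) in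
           con 80 :* (n :* (n :+ con 10)) :+ con 640
             :+ (con 90 :* (n₀ :* (n₀ :+ con 10)) :+ con 40 :* (n₁ :* (n₁ :+ con 10)) :+ con 90 :* (n₂ :* (n₂ :+ con 10)))
             :+ (con 380 :+ con 1800 :* m :+ con 340 :* (m :* m))
           := con 8 :* (con 8 :* (con 10 :* (a :* a)))) refl m) ⟩
    8 * (8 * (10 * (a * a)))
      ≡⟨ cong (λ g → 8 * (8 * g)) (G-quadratic a (s≤s (s≤s (ℕₚ.m≤n+m 4 m)))) ⟨
    8 * (8 * G a) ∎)
    where
    open ℕₚ.≤-Reasoning
    open ℕ-Solver
    a N N₀ N₁ N₂ : ℕ
    a = suc (suc m) + 4
    N = suc (a + 0)
    N₀ = suc (suc (suc m) + 0)
    N₁ = suc (suc (suc m) + 1)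
    N₂ = suc (suc (suc m) + 2)
    bound : ∀ c n → c * (8 * σ n) ≤ c * (n * (n + 10))
    bound c n = ℕₚ.*-monoʳ-≤ c (8σ[n]≤n[n+10] n)

module Analysis where

  open Arithmetic using (Σℕ; G; 10≤G; G-subsolution; σ-ratio; σ-bound-k≡1; σ-bound-k≡2; σ-bound-b≡1)
  open import Data.Fin.Base as Fin using (Fin; toℕ)
  open import Data.Nat.Base as ℕ using (ℕ; zero; suc; _∸_; s≤s; z≤n)
  import Data.Nat.Properties as ℕₚ
  open import Data.Nat.Coprimality using (1-coprimeTo) renaming (sym to coprime-sym)
  open import Data.Nat.Induction using (<-rec)
  import Data.Integer.Base as ℤ
  import Data.Integer.Properties as ℤₚ
  open import Data.Product.Base using (_,_)
  open import Data.Rational.Base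
    using (ℚ; 0ℚ; 1ℚ; ½; _/_; _+_; _*_; _-_; -_; _≤_; *≤*; nonNegative; NonNegative)
  open import Data.Rational.Literals using (fromℤ)
  import Data.Rational.Properties as ℚₚ
  open import Data.Rational.Solver using (module +-*-Solver)
  open import Data.Sum.Base using (inj₁; inj₂)
  open import Relation.Binary.PropositionalEquality
    using (_≡_; refl; sym; trans; cong; cong₂; subst; subst₂; module ≡-Reasoning)
  open +-*-Solver

  -- Naturals in ℚ and elementary inequalities

  ι : ℕ → ℚ
  ι n = fromℤ (ℤ.+ n)

  -- `_/_` normalises through a gcd that is stuck on a variable, while `fromℤ` stores the
  -- denominator 1 outright; this bridges the two forms.
  /1≡ι : ∀ n → ℤ.+ n / 1 ≡ ι n
  /1≡ι n = ℚₚ.normalize-coprime (coprime-sym (1-coprimeTo n))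

  ι-+ : ∀ m n → ι (m ℕ.+ n) ≡ ι m + ι n
  ι-+ m n = sym (trans
    (cong (_/ 1) (cong₂ ℤ._+_ (ℤₚ.*-identityʳ (ℤ.+ m)) (ℤₚ.*-identityʳ (ℤ.+ n))))
    (/1≡ι (m ℕ.+ n)))

  ι-* : ∀ m n → ι (m ℕ.* n) ≡ ι m * ι n
  ι-* m n = sym (trans (cong (_/ 1) (sym (ℤₚ.pos-* m n))) (/1≡ι (m ℕ.* n)))

  0≤ι : ∀ n → 0ℚ ≤ ι n
  0≤ι n = ℚₚ.nonNegative⁻¹ (ι n)

  0≤+ : ∀ {p q} → 0ℚ ≤ p → 0ℚ ≤ q → 0ℚ ≤ p + q
  0≤+ = ℚₚ.+-mono-≤

  *-monoʳ : ∀ {r p q} → 0ℚ ≤ r → p ≤ q → r * p ≤ r * q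
  *-monoʳ {r} 0≤r = ℚₚ.*-monoˡ-≤-nonNeg r {{nonNegative 0≤r}}

  0≤* : ∀ {p q} → 0ℚ ≤ p → 0ℚ ≤ q → 0ℚ ≤ p * q
  0≤* {p} {q} 0≤p 0≤q = subst (_≤ p * q) (ℚₚ.*-zeroʳ p) (*-monoʳ 0≤p 0≤q)

  p≤p+r : ∀ {p r} → 0ℚ ≤ r → p ≤ p + r
  p≤p+r {p} {r} 0≤r = subst (_≤ p + r) (ℚₚ.+-identityʳ p) (ℚₚ.+-monoʳ-≤ p 0≤r)

  ≤-by : ∀ {p q r} → p + r ≡ q → 0ℚ ≤ r → p ≤ q
  ≤-by eq 0≤r = subst (_ ≤_) eq (p≤p+r 0≤r)

  0≤q-p : ∀ {p q} → p ≤ q → 0ℚ ≤ q - p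
  0≤q-p {p} {q} p≤q = subst (_≤ q - p) (ℚₚ.+-inverseʳ p) (ℚₚ.+-monoˡ-≤ (- p) p≤q)

  ι-mono : ∀ {m n} → m ℕ.≤ n → ι m ≤ ι n
  ι-mono {m} {n} m≤n = ≤-by (trans (sym (ι-+ m (n ∸ m))) (cong ι (ℕₚ.m+[n∸m]≡n m≤n))) (0≤ι (n ∸ m))

  ι-affine : ∀ n t u v → ι (80 ℕ.* n ℕ.+ 80 ℕ.+ (90 ℕ.* t ℕ.+ 40 ℕ.* u ℕ.+ 90 ℕ.* v))
    ≡ ι 80 * ι n + ι 80 + (ι 90 * ι t + ι 40 * ι u + ι 90 * ι v)
  ι-affine n t u v = trans (ι-+ (80 ℕ.* n ℕ.+ 80) (90 ℕ.* t ℕ.+ 40 ℕ.* u ℕ.+ 90 ℕ.* v)) (cong₂ _+_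
    (trans (ι-+ (80 ℕ.* n) 80) (cong (_+ ι 80) (ι-* 80 n)))
    (trans (ι-+ (90 ℕ.* t ℕ.+ 40 ℕ.* u) (90 ℕ.* v)) (cong₂ _+_
      (trans (ι-+ (90 ℕ.* t) (40 ℕ.* u)) (cong₂ _+_ (ι-* 90 t) (ι-* 40 u)))
      (ι-* 90 v))))

  0≤-cancel : ∀ n {q} → 1ℚ ≤ ι n * q → 0ℚ ≤ q
  0≤-cancel zero    {q} 1≤0 with subst (1ℚ ≤_) (ℚₚ.*-zeroˡ q) 1≤0
  ... | *≤* (ℤ.+≤+ ())
  0≤-cancel (suc n) {q} 1≤nq = ℚₚ.*-cancelˡ-≤-pos (ι (suc n))
    (subst (_≤ ι (suc n) * q) (sym (ℚₚ.*-zeroʳ (ι (suc n)))) (ℚₚ.≤-trans (ℚₚ.≤ᵇ⇒≤ _) 1≤nq))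

  -- Finite sums of rationals

  Σ : ℕ → (ℕ → ℚ) → ℚ
  Σ zero    f = 0ℚ
  Σ (suc n) f = f 0 + Σ n (λ j → f (suc j))

  Σ-mono : ∀ n {f g} → (∀ j → j ℕ.< n → f j ≤ g j) → Σ n f ≤ Σ n g
  Σ-mono zero    f≤g = ℚₚ.≤-refl
  Σ-mono (suc n) f≤g = ℚₚ.+-mono-≤ (f≤g 0 (s≤s z≤n)) (Σ-mono n (λ j j<n → f≤g (suc j) (s≤s j<n)))

  0≤Σ : ∀ n {f} → (∀ j → j ℕ.< n → 0ℚ ≤ f j) → 0ℚ ≤ Σ n f
  0≤Σ zero    0≤f = ℚₚ.≤-refl
  0≤Σ (suc n) 0≤f = 0≤+ (0≤f 0 (s≤s z≤n)) (0≤Σ n (λ j j<n → 0≤f (suc j) (s≤s j<n)))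

  Σ-++ : ∀ m n f → Σ (m ℕ.+ n) f ≡ Σ m f + Σ n (λ j → f (m ℕ.+ j))
  Σ-++ zero    n f = sym (ℚₚ.+-identityˡ (Σ n f))
  Σ-++ (suc m) n f = trans (cong (f 0 +_) (Σ-++ m n (λ j → f (suc j)))) (sym (ℚₚ.+-assoc (f 0) _ _))

  Σ-linear : ∀ n c {f g h} → (∀ j → j ℕ.< n → h j ≡ c * f j - g j) → Σ n h ≡ c * Σ n f - Σ n g
  Σ-linear zero    c eq = solve 1 (λ c → con 0ℚ := c :* con 0ℚ :- con 0ℚ) refl c
  Σ-linear (suc n) c {f} {g} {h} eq = trans
    (cong₂ _+_ (eq 0 (s≤s z≤n)) (Σ-linear n c (λ j j<n → eq (suc j) (s≤s j<n))))
    (solve 5 (λ c x y x′ y′ → (c :* x :- y) :+ (c :* x′ :- y′) := c :* (x :+ x′) :- (y :+ y′)) refl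
      c (f 0) (g 0) (Σ n (λ j → f (suc j))) (Σ n (λ j → g (suc j))))

  *-Σ : ∀ n c f → Σ n (λ j → c * f j) ≡ c * Σ n f
  *-Σ zero    c f = sym (ℚₚ.*-zeroʳ c)
  *-Σ (suc n) c f = trans (cong (c * f 0 +_) (*-Σ n c (λ j → f (suc j))))
    (sym (ℚₚ.*-distribˡ-+ c (f 0) _))

  ι-Σ : ∀ n f → ι (Σℕ n f) ≡ Σ n (λ j → ι (f j))
  ι-Σ zero    f = refl
  ι-Σ (suc n) f = trans (ι-+ (f 0) _) (cong (ι (f 0) +_) (ι-Σ n (λ j → f (suc j))))

  seq-∑ : ∀ {n} {F : Fin n → ℝ} {f i} → (∀ k → seq (F k) i ≡ f (toℕ k)) → seq (∑ F) i ≡ Σ n f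
  seq-∑ {zero}  eq = refl
  seq-∑ {suc n} eq = cong₂ _+_ (eq Fin.zero) (seq-∑ (λ k → eq (Fin.suc k)))

  ⅓ ¼ ⅙ 1/24 : ℚ
  ⅓ = ℤ.+ 1 / 3
  ¼ = ℤ.+ 1 / 4
  ⅙ = ℤ.+ 1 / 6
  1/24 = ℤ.+ 1 / 24

  -- Rational D'Arcais sequences and the recurrence for the defect

  s : ℕ → ℚ
  s n = ι (σ n)

  -- Real arithmetic acts termwise, so the i-th term of P_n(x) is the value of the polynomial at the
  -- rational i-th term of x. The whole induction can thus be done over ℚ, for any sequence obeying
  -- the recursion, here with the denominator cleared.
  record IsDArcais (x : ℚ) (p : ℕ → ℚ) : Set where
    field
      p-zero : p 0 ≡ 1ℚ
      p-suc  : ∀ n → ι (suc n) * p (suc n) ≡ x * Σ (suc n) (λ j → s (suc j) * p (n ∸ j))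

  module _ {x : ℚ} {p : ℕ → ℚ} (isDArcais : IsDArcais x p) where
    open IsDArcais isDArcais

    conv : ℕ → ℚ
    conv n = Σ n (λ j → s (suc j) * p (n ∸ suc j))

    recurrence : ∀ n → ι n * p n ≡ x * conv n
    recurrence zero    = trans (ℚₚ.*-zeroˡ (p 0)) (sym (ℚₚ.*-zeroʳ x))
    recurrence (suc n) = p-suc n

    defect : ℕ → ℕ → ℚ
    defect a b = p a * p b - p (a ℕ.+ b)

    defect-sym : ∀ a b → defect a b ≡ defect b a
    defect-sym a b = cong₂ _-_ (ℚₚ.*-comm (p a) (p b)) (cong p (ℕₚ.+-comm a b))

    defect-zero : ∀ b → defect 0 b ≡ 0ℚ
    defect-zero b = trans (cong (λ q → q * p b - p b) p-zero)
      (solve 1 (λ q → con 1ℚ :* q :- q := con 0ℚ) refl (p b))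

    inner outer : ℕ → ℕ → ℕ → ℚ
    inner a b j = s (suc j) * defect (a ∸ suc j) b
    outer a b j = p (b ∸ suc j) * (p a * s (suc j) - s (suc (a ℕ.+ j)))

    -- A Leibniz rule for the factor n in the recursion: (a+b) P_a P_b = (a P_a) P_b + P_a (b P_b).
    -- The terms k ≤ a of the convolution for P_{a+b} are paired with those of P_a, the later ones
    -- with those of P_b.
    defect-recurrence : ∀ a b →
      ι (a ℕ.+ b) * defect a b ≡ x * (Σ a (inner a b) + Σ b (outer a b))
    defect-recurrence a b = begin
      ι (a ℕ.+ b) * defect a b
        ≡⟨ solve 4 (λ n u v w → n :* (u :* v :- w) := n :* (u :* v) :- n :* w) refl (ι (a ℕ.+ b)) (p a) (p b) (p (a ℕ.+ b)) ⟩
      ι (a ℕ.+ b) * (p a * p b) - ι (a ℕ.+ b) * p (a ℕ.+ b)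
        ≡⟨ cong₂ (λ n w → n * (p a * p b) - w) (ι-+ a b)
             (trans (recurrence (a ℕ.+ b)) (cong (x *_) (Σ-++ a b _))) ⟩
      (ι a + ι b) * (p a * p b) - x * (U + V)
        ≡⟨ solve 7 (λ m n u v x k l → (m :+ n) :* (u :* v) :- x :* (k :+ l) := (m :* u) :* v :+ u :* (n :* v) :- x :* (k :+ l)) refl
             (ι a) (ι b) (p a) (p b) x U V ⟩
      (ι a * p a) * p b + p a * (ι b * p b) - x * (U + V)
        ≡⟨ cong₂ (λ y z → y * p b + p a * z - x * (U + V)) (recurrence a) (recurrence b) ⟩
      (x * conv a) * p b + p a * (x * conv b) - x * (U + V)
        ≡⟨ solve 7 (λ u v x y z k l → (x :* y) :* v :+ u :* (x :* z) :- x :* (k :+ l) := x :* ((v :* y :- k) :+ (u :* z :- l))) refl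
             (p a) (p b) x (conv a) (conv b) U V ⟩
      x * ((p b * conv a - U) + (p a * conv b - V))
        ≡⟨ cong (x *_) (cong₂ _+_ Σ-inner Σ-outer) ⟨
      x * (Σ a (inner a b) + Σ b (outer a b)) ∎
      where
      open ≡-Reasoning
      U V : ℚ
      U = Σ a (λ j → s (suc j) * p ((a ℕ.+ b) ∸ suc j))
      V = Σ b (λ j → s (suc (a ℕ.+ j)) * p ((a ℕ.+ b) ∸ suc (a ℕ.+ j)))
      Σ-inner : Σ a (inner a b) ≡ p b * conv a - U
      Σ-inner = Σ-linear a (p b) (λ j j<a → trans
        (cong (λ i → s (suc j) * (p (a ∸ suc j) * p b - p i)) (sym (ℕₚ.+-∸-comm b j<a)))
        (solve 4 (λ t u v w → t :* (u :* v :- w) := v :* (t :* u) :- t :* w) refl (s (suc j)) (p (a ∸ suc j)) (p b) (p ((a ℕ.+ b) ∸ suc j))))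
      Σ-outer : Σ b (outer a b) ≡ p a * conv b - V
      Σ-outer = Σ-linear b (p a) (λ j _ → trans
        (solve 4 (λ q u t w → q :* (u :* t :- w) := u :* (t :* q) :- w :* q) refl (p (b ∸ suc j)) (p a) (s (suc j)) (s (suc (a ℕ.+ j))))
        (cong (λ i → p a * (s (suc j) * p (b ∸ suc j)) - s (suc (a ℕ.+ j)) * p i)
          (sym (trans (cong ((a ℕ.+ b) ∸_) (sym (ℕₚ.+-suc a j))) (ℕₚ.[m+n]∸[m+o]≡n∸o a b (suc j))))))

    module _ (9/5≤x : ℤ.+ 9 / 5 ≤ x) where

      -- Lower bound for P_n at x ≥ 9/5

      0≤x : 0ℚ ≤ x
      0≤x = ℚₚ.≤-trans (ℚₚ.≤ᵇ⇒≤ _) 9/5≤x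

      -- Comparison principle: the coefficients are nonnegative, so a subsolution at 9/5 stays below
      -- the solution at every x ≥ 9/5.
      p-lower-step : ∀ n → (∀ {m} → m ℕ.< suc n → ι (G m) ≤ ι 10 * p m) → ι (G (suc n)) ≤ ι 10 * p (suc n)
      p-lower-step n ih = ℚₚ.*-cancelˡ-≤-pos (ι 5n) (begin
        ι 5n * ι (G (suc n))                ≡⟨ ι-* 5n (G (suc n)) ⟨
        ι (5n ℕ.* G (suc n))                ≡⟨ cong ι (ℕₚ.*-assoc 5 (suc n) (G (suc n))) ⟩
        ι (5 ℕ.* (suc n ℕ.* G (suc n)))     ≤⟨ ι-mono (G-subsolution n) ⟩
        ι (9 ℕ.* S)                         ≡⟨ trans (ι-* 9 S) (cong (ι 9 *_) (ι-Σ (suc n) (λ j → σ (suc j) ℕ.* G (n ∸ j)))) ⟩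
        ι 9 * T
          ≤⟨ ≤-by (solve 2 (λ t x → con (ι 9) :* t :+ con (ι 5) :* (t :* (x :- con (ℤ.+ 9 / 5))) := con (ι 5) :* (x :* t)) refl T x)
               (0≤* (0≤ι 5) (0≤* (0≤Σ (suc n) (λ j _ → 0≤ι (σ (suc j) ℕ.* G (n ∸ j)))) (0≤q-p 9/5≤x))) ⟩
        ι 5 * (x * T)                       ≤⟨ *-monoʳ (0≤ι 5) (*-monoʳ 0≤x T≤) ⟩
        ι 5 * (x * (ι 10 * conv (suc n)))
          ≡⟨ solve 2 (λ x c → con (ι 5) :* (x :* (con (ι 10) :* c)) := con (ι 10) :* (con (ι 5) :* (x :* c))) refl x (conv (suc n)) ⟩
        ι 10 * (ι 5 * (x * conv (suc n)))   ≡⟨ cong (λ q → ι 10 * (ι 5 * q)) (recurrence (suc n)) ⟨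
        ι 10 * (ι 5 * (ι (suc n) * p (suc n)))
          ≡⟨ solve 2 (λ m q → con (ι 10) :* (con (ι 5) :* (m :* q)) := (con (ι 5) :* m) :* (con (ι 10) :* q)) refl (ι (suc n)) (p (suc n)) ⟩
        (ι 5 * ι (suc n)) * (ι 10 * p (suc n))  ≡⟨ cong (_* (ι 10 * p (suc n))) (ι-* 5 (suc n)) ⟨
        ι 5n * (ι 10 * p (suc n)) ∎)
        where
        open ℚₚ.≤-Reasoning
        T : ℚ
        T = Σ (suc n) (λ j → ι (σ (suc j) ℕ.* G (n ∸ j)))
        5n S : ℕ
        5n = 5 ℕ.* suc n
        S = Σℕ (suc n) (λ j → σ (suc j) ℕ.* G (n ∸ j))
        T≤ : T ≤ ι 10 * conv (suc n)
        T≤ = subst (T ≤_) (*-Σ (suc n) (ι 10) (λ j → s (suc j) * p (n ∸ j))) (Σ-mono (suc n) (λ j _ → begin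
          ι (σ (suc j) ℕ.* G (n ∸ j))       ≡⟨ ι-* (σ (suc j)) (G (n ∸ j)) ⟩
          s (suc j) * ι (G (n ∸ j))         ≤⟨ *-monoʳ (0≤ι (σ (suc j))) (ih (s≤s (ℕₚ.m∸n≤m n j))) ⟩
          s (suc j) * (ι 10 * p (n ∸ j))    ≡⟨ solve 2 (λ t q → t :* (con (ι 10) :* q) := con (ι 10) :* (t :* q)) refl (s (suc j)) (p (n ∸ j)) ⟩
          ι 10 * (s (suc j) * p (n ∸ j))    ∎))

      p-lower : ∀ n → ι (G n) ≤ ι 10 * p n
      p-lower = <-rec _ λ
        { zero    _  → ℚₚ.≤-reflexive (cong (ι 10 *_) (sym p-zero))
        ; (suc n) ih → p-lower-step n ih
        }

      1≤p : ∀ n → 1ℚ ≤ p n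
      1≤p n = ℚₚ.*-cancelˡ-≤-pos (ι 10) (ℚₚ.≤-trans (ι-mono (10≤G n)) (p-lower n))

      0≤p : ∀ n → 0ℚ ≤ p n
      0≤p n = ℚₚ.≤-trans (ℚₚ.≤ᵇ⇒≤ _) (1≤p n)

      -- Closed forms and defects with a + b ≤ 4

      p₁ : p 1 ≡ x
      p₁ = begin
        p 1                          ≡⟨ ℚₚ.*-identityˡ (p 1) ⟨
        ι 1 * p 1                    ≡⟨ recurrence 1 ⟩
        x * (ι 1 * p 0 + 0ℚ)         ≡⟨ cong (λ q → x * (ι 1 * q + 0ℚ)) p-zero ⟩
        x * (ι 1 * 1ℚ + 0ℚ)          ≡⟨ ℚₚ.*-identityʳ x ⟩
        x                            ∎
        where open ≡-Reasoning

      p₂ : p 2 ≡ ½ * (x * (x + ι 3))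
      p₂ = begin
        p 2                                  ≡⟨ solve 1 (λ q → q := con ½ :* (con (ι 2) :* q)) refl (p 2) ⟩
        ½ * (ι 2 * p 2)                      ≡⟨ cong (½ *_) (recurrence 2) ⟩
        ½ * (x * (ι 1 * p 1 + (ι 3 * p 0 + 0ℚ)))
          ≡⟨ cong₂ (λ q r → ½ * (x * (ι 1 * q + (ι 3 * r + 0ℚ)))) p₁ p-zero ⟩
        ½ * (x * (ι 1 * x + (ι 3 * 1ℚ + 0ℚ)))
          ≡⟨ solve 1 (λ x → con ½ :* (x :* (con (ι 1) :* x :+ (con (ι 3) :* con 1ℚ :+ con 0ℚ))) := con ½ :* (x :* (x :+ con (ι 3)))) refl x ⟩
        ½ * (x * (x + ι 3)) ∎
        where open ≡-Reasoning

      p₃ : p 3 ≡ ⅙ * (x * (x * x + ι 9 * x + ι 8))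
      p₃ = begin
        p 3                    ≡⟨ solve 1 (λ q → q := con ⅓ :* (con (ι 3) :* q)) refl (p 3) ⟩
        ⅓ * (ι 3 * p 3)        ≡⟨ cong (⅓ *_) (recurrence 3) ⟩
        ⅓ * (x * (ι 1 * p 2 + (ι 3 * p 1 + (ι 4 * p 0 + 0ℚ))))
          ≡⟨ cong₂ (λ q r → ⅓ * (x * (ι 1 * q + (ι 3 * p 1 + (ι 4 * r + 0ℚ))))) p₂ p-zero ⟩
        ⅓ * (x * (ι 1 * (½ * (x * (x + ι 3))) + (ι 3 * p 1 + (ι 4 * 1ℚ + 0ℚ))))
          ≡⟨ cong (λ q → ⅓ * (x * (ι 1 * (½ * (x * (x + ι 3))) + (ι 3 * q + (ι 4 * 1ℚ + 0ℚ))))) p₁ ⟩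
        ⅓ * (x * (ι 1 * (½ * (x * (x + ι 3))) + (ι 3 * x + (ι 4 * 1ℚ + 0ℚ))))
          ≡⟨ solve 1 (λ x → con ⅓ :* (x :* (con (ι 1) :* (con ½ :* (x :* (x :+ con (ι 3)))) :+ (con (ι 3) :* x :+ (con (ι 4) :* con 1ℚ :+ con 0ℚ))))
               := con ⅙ :* (x :* (x :* x :+ con (ι 9) :* x :+ con (ι 8)))) refl x ⟩
        ⅙ * (x * (x * x + ι 9 * x + ι 8)) ∎
        where open ≡-Reasoning

      p₄ : p 4 ≡ 1/24 * (x * (x * (x * x) + ι 18 * (x * x) + ι 59 * x + ι 42))
      p₄ = begin
        p 4                    ≡⟨ solve 1 (λ q → q := con ¼ :* (con (ι 4) :* q)) refl (p 4) ⟩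
        ¼ * (ι 4 * p 4)        ≡⟨ cong (¼ *_) (recurrence 4) ⟩
        ¼ * (x * (ι 1 * p 3 + (ι 3 * p 2 + (ι 4 * p 1 + (ι 7 * p 0 + 0ℚ)))))
          ≡⟨ cong₂ (λ q r → ¼ * (x * (ι 1 * q + (ι 3 * r + (ι 4 * p 1 + (ι 7 * p 0 + 0ℚ)))))) p₃ p₂ ⟩
        ¼ * (x * (ι 1 * P₃ + (ι 3 * P₂ + (ι 4 * p 1 + (ι 7 * p 0 + 0ℚ)))))
          ≡⟨ cong₂ (λ q r → ¼ * (x * (ι 1 * P₃ + (ι 3 * P₂ + (ι 4 * q + (ι 7 * r + 0ℚ)))))) p₁ p-zero ⟩
        ¼ * (x * (ι 1 * P₃ + (ι 3 * P₂ + (ι 4 * x + (ι 7 * 1ℚ + 0ℚ)))))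
          ≡⟨ solve 1 (λ x → con ¼ :* (x :* (con (ι 1) :* (con ⅙ :* (x :* (x :* x :+ con (ι 9) :* x :+ con (ι 8))))
                 :+ (con (ι 3) :* (con ½ :* (x :* (x :+ con (ι 3)))) :+ (con (ι 4) :* x :+ (con (ι 7) :* con 1ℚ :+ con 0ℚ)))))
               := con 1/24 :* (x :* (x :* (x :* x) :+ con (ι 18) :* (x :* x) :+ con (ι 59) :* x :+ con (ι 42)))) refl x ⟩
        1/24 * (x * (x * (x * x) + ι 18 * (x * x) + ι 59 * x + ι 42)) ∎
        where
        open ≡-Reasoning
        P₂ P₃ : ℚ
        P₂ = ½ * (x * (x + ι 3))
        P₃ = ⅙ * (x * (x * x + ι 9 * x + ι 8))

      y : ℚ
      y = x - ℤ.+ 9 / 5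

      0≤y : 0ℚ ≤ y
      0≤y = 0≤q-p 9/5≤x

      horner : ∀ c {q} .{{_ : NonNegative c}} → 0ℚ ≤ q → 0ℚ ≤ c + y * q
      horner c 0≤q = 0≤+ (ℚₚ.nonNegative⁻¹ c) (0≤* 0≤y 0≤q)

      -- Completing the square, x² - x(x+3)/2 = (x - 3/2)²/2 - 9/8, and `y + 3/10` is x - 3/2. This
      -- is the origin of 9/8, which also suffices for D(1, 2) and D(1, 3).
      defect₁₁ : 0ℚ ≤ defect 1 1 + ℤ.+ 9 / 8
      defect₁₁ = subst (0ℚ ≤_) (sym (trans
        (cong₂ (λ q r → q * q - r + ℤ.+ 9 / 8) p₁ p₂)
        (solve 1 (λ x → x :* x :- con ½ :* (x :* (x :+ con (ι 3))) :+ con (ℤ.+ 9 / 8)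
          := con ½ :* ((x :- con (ℤ.+ 9 / 5) :+ con (ℤ.+ 3 / 10)) :* (x :- con (ℤ.+ 9 / 5) :+ con (ℤ.+ 3 / 10)))) refl x)))
        (0≤* {½} (ℚₚ.≤ᵇ⇒≤ _) (0≤* 0≤y+3/10 0≤y+3/10))
        where
        0≤y+3/10 : 0ℚ ≤ y + ℤ.+ 3 / 10
        0≤y+3/10 = 0≤+ 0≤y (ℚₚ.≤ᵇ⇒≤ _)

      -- Expanded in y = x - 9/5, the remaining polynomials have nonnegative coefficients only.
      defect₁₂ : 0ℚ ≤ defect 1 2 + ½
      defect₁₂ = subst (0ℚ ≤_) (sym (trans
        (cong (λ r → p 1 * p 2 - r + ½) p₃)
        (trans (cong₂ (λ q r → q * r - ⅙ * (x * (x * x + ι 9 * x + ι 8)) + ½) p₁ p₂)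
        (solve 1 (λ x → let y = x :- con (ℤ.+ 9 / 5) in
          x :* (con ½ :* (x :* (x :+ con (ι 3)))) :- con ⅙ :* (x :* (x :* x :+ con (ι 9) :* x :+ con (ι 8))) :+ con ½
          := con (ℤ.+ 11 / 250) :+ y :* (con (ℤ.+ 143 / 75) :+ y :* (con (ℤ.+ 9 / 5) :+ y :* con ⅓))) refl x))))
        (horner (ℤ.+ 11 / 250) (horner (ℤ.+ 143 / 75) (horner (ℤ.+ 9 / 5) (ℚₚ.≤ᵇ⇒≤ {0ℚ} {⅓} _))))

      defect₁₃ : 0ℚ ≤ defect 1 3 + ℤ.+ 9 / 8
      defect₁₃ = subst (0ℚ ≤_) (sym (trans
        (cong (λ r → p 1 * p 3 - r + ℤ.+ 9 / 8) p₄)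
        (trans (cong₂ (λ q r → q * r - 1/24 * (x * (x * (x * x) + ι 18 * (x * x) + ι 59 * x + ι 42)) + ℤ.+ 9 / 8) p₁ p₃)
        (solve 1 (λ x → let y = x :- con (ℤ.+ 9 / 5) in
          x :* (con ⅙ :* (x :* (x :* x :+ con (ι 9) :* x :+ con (ι 8))))
            :- con 1/24 :* (x :* (x :* (x :* x) :+ con (ι 18) :* (x :* x) :+ con (ι 59) :* x :+ con (ι 42))) :+ con (ℤ.+ 9 / 8)
          := con (ℤ.+ 81 / 5000) :+ y :* (con (ℤ.+ 2203 / 500) :+ y :* (con (ℤ.+ 1071 / 200) :+ y :* (con (ℤ.+ 33 / 20) :+ y :* con (ℤ.+ 1 / 8))))) refl x))))
        (horner (ℤ.+ 81 / 5000) (horner (ℤ.+ 2203 / 500) (horner (ℤ.+ 1071 / 200) (horner (ℤ.+ 33 / 20) (ℚₚ.≤ᵇ⇒≤ {0ℚ} {ℤ.+ 1 / 8} _)))))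

      defect₂₂ : 0ℚ ≤ defect 2 2
      defect₂₂ = subst (0ℚ ≤_) (sym (trans
        (cong₂ (λ q r → q * q - r) p₂ p₄)
        (solve 1 (λ x → let y = x :- con (ℤ.+ 9 / 5) in
          con ½ :* (x :* (x :+ con (ι 3))) :* (con ½ :* (x :* (x :+ con (ι 3))))
            :- con 1/24 :* (x :* (x :* (x :* x) :+ con (ι 18) :* (x :* x) :+ con (ι 59) :* x :+ con (ι 42)))
          := con (ℤ.+ 342 / 125) :+ y :* (con (ℤ.+ 193 / 20) :+ y :* (con (ℤ.+ 947 / 120) :+ y :* (con (ℤ.+ 9 / 4) :+ y :* con (ℤ.+ 5 / 24))))) refl x)))
        (horner (ℤ.+ 342 / 125) (horner (ℤ.+ 193 / 20) (horner (ℤ.+ 947 / 120) (horner (ℤ.+ 9 / 4) (ℚₚ.≤ᵇ⇒≤ {0ℚ} {ℤ.+ 5 / 24} _)))))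

      -- The induction step

      inner-term : ∀ m k i b → inner (m ℕ.+ k) b (m ℕ.+ i) ≡ s (suc (m ℕ.+ i)) * defect (k ∸ suc i) b
      inner-term m k i b = cong (λ c → s (suc (m ℕ.+ i)) * defect c b)
        (trans (cong ((m ℕ.+ k) ∸_) (sym (ℕₚ.+-suc m i))) (ℕₚ.[m+n]∸[m+o]≡n∸o m k (suc i)))

      inner-zero : ∀ m k i b → k ∸ suc i ≡ 0 → inner (m ℕ.+ k) b (m ℕ.+ i) ≡ 0ℚ
      inner-zero m k i b eq = trans (inner-term m k i b) (trans
        (cong (s (suc (m ℕ.+ i)) *_) (trans (cong (λ c → defect c b) eq) (defect-zero b)))
        (ℚₚ.*-zeroʳ (s (suc (m ℕ.+ i)))))

      -- In the first `m` terms the first index of the defect runs over k, ..., m+k-1, so `k` can be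
      -- chosen to set aside the terms that may be negative.
      0≤Σ-inner : ∀ m k b → (∀ i → i ℕ.< m → 0ℚ ≤ defect (i ℕ.+ k) b) → 0ℚ ≤ Σ m (inner (m ℕ.+ k) b)
      0≤Σ-inner m k b 0≤defect = 0≤Σ m λ j j<m → 0≤* (0≤ι (σ (suc j)))
        (subst (λ c → 0ℚ ≤ defect c b) (sym (ℕₚ.+-∸-comm k j<m)) (0≤defect (m ∸ suc j) (shrink j<m)))
        where
        shrink : ∀ {j m} → j ℕ.< m → m ∸ suc j ℕ.< m
        shrink {j} {suc m} _ = s≤s (ℕₚ.m∸n≤m m j)

      ι-G-≤ : ∀ c n → ι (c ℕ.* G n) ≤ ι c * (ι 10 * p n)
      ι-G-≤ c n = subst (_≤ ι c * (ι 10 * p n)) (sym (ι-* c (G n))) (*-monoʳ (0≤ι c) (p-lower n))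

      p-σ-ratio : ∀ a j → 3 ℕ.≤ a → j ℕ.< a → s (suc (a ℕ.+ j)) ≤ p a * s (suc j)
      p-σ-ratio a j 3≤a j<a = ℚₚ.*-cancelˡ-≤-pos (ι 10) (begin
        ι 10 * s (suc (a ℕ.+ j))          ≡⟨ ι-* 10 (σ (suc (a ℕ.+ j))) ⟨
        ι (10 ℕ.* σ (suc (a ℕ.+ j)))      ≤⟨ ι-mono (σ-ratio a j 3≤a j<a) ⟩
        ι (G a ℕ.* σ (suc j))             ≡⟨ cong ι (ℕₚ.*-comm (G a) (σ (suc j))) ⟩
        ι (σ (suc j) ℕ.* G a)             ≤⟨ ι-G-≤ (σ (suc j)) a ⟩
        s (suc j) * (ι 10 * p a)          ≡⟨ solve 2 (λ t q → t :* (con (ι 10) :* q) := con (ι 10) :* (q :* t)) refl (s (suc j)) (p a) ⟩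
        ι 10 * (p a * s (suc j))          ∎)
        where open ℚₚ.≤-Reasoning

      0≤outer : ∀ a b j → 3 ℕ.≤ a → j ℕ.< a → 0ℚ ≤ outer a b j
      0≤outer a b j 3≤a j<a = 0≤* (0≤p (b ∸ suc j)) (0≤q-p (p-σ-ratio a j 3≤a j<a))

      -- The induction hypothesis in the weak form in which it is used. Sums below 5 are excluded
      -- because D(1, 1), D(1, 2) and D(1, 3) are negative at x = 9/5.
      NonnegativeBelow : ℕ → Set
      NonnegativeBelow n = ∀ a b → 0 ℕ.< a → 0 ℕ.< b → 5 ℕ.≤ a ℕ.+ b → a ℕ.+ b ℕ.< n → 0ℚ ≤ defect a b

      0≤defect-≥2 : ∀ {n} → NonnegativeBelow n → ∀ a b → 2 ℕ.≤ a → 2 ℕ.≤ b → a ℕ.+ b ℕ.< n → 0ℚ ≤ defect a b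
      0≤defect-≥2 below 0 _ () _ _
      0≤defect-≥2 below 1 _ (s≤s ()) _ _
      0≤defect-≥2 below (suc (suc _)) 0 _ () _
      0≤defect-≥2 below (suc (suc _)) 1 _ (s≤s ()) _
      0≤defect-≥2 below 2 2 _ _ _ = defect₂₂
      0≤defect-≥2 below 2 (suc (suc (suc b))) _ _ a+b<n = below 2 (3 ℕ.+ b) (s≤s z≤n) (s≤s z≤n) (s≤s (s≤s (s≤s (s≤s (s≤s z≤n))))) a+b<n
      0≤defect-≥2 below (suc (suc (suc a))) (suc (suc b)) _ _ a+b<n = below (3 ℕ.+ a) (2 ℕ.+ b) (s≤s z≤n) (s≤s z≤n)
        (ℕₚ.+-mono-≤ (s≤s (s≤s (s≤s (z≤n {a})))) (s≤s (s≤s (z≤n {b})))) a+b<n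

      defect-one : ∀ {n} → NonnegativeBelow n → ∀ b → 0 ℕ.< b → 1 ℕ.+ b ℕ.< n → 0ℚ ≤ defect 1 b + ℤ.+ 9 / 8
      defect-one below 1 _ _ = defect₁₁
      defect-one below 2 _ _ = ℚₚ.≤-trans defect₁₂ (ℚₚ.+-monoʳ-≤ (defect 1 2) (ℚₚ.≤ᵇ⇒≤ _))
      defect-one below 3 _ _ = defect₁₃
      defect-one below b@(suc (suc (suc (suc _)))) 0<b 1+b<n =
        0≤+ (below 1 b (s≤s z≤n) 0<b (s≤s (s≤s (s≤s (s≤s (s≤s z≤n))))) 1+b<n) (ℚₚ.≤ᵇ⇒≤ _)

      bracket : ℕ → ℕ → ℚ
      bracket a b = Σ a (inner a b) + Σ b (outer a b)

      -- The form `m + 4` cuts the first sum before D(3, 1), D(2, 1), D(1, 1) and D(0, 1) = 0; all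
      -- earlier pairs have sum at least 5. The second sum is the single term P_0 (P_a - σ(a+1)).
      1≤bracket-b≡1 : ∀ m → NonnegativeBelow (m ℕ.+ 4 ℕ.+ 1) → 1ℚ ≤ bracket (m ℕ.+ 4) 1
      1≤bracket-b≡1 m below = ≤-by certificate
        (0≤+ (0≤+ 0≤R
          (0≤+ (0≤* (0≤ι (σ (suc (m ℕ.+ 0)))) (subst (λ d → 0ℚ ≤ d + ℤ.+ 9 / 8) (defect-sym 1 3) defect₁₃))
          (0≤+ (0≤* (0≤ι (σ (suc (m ℕ.+ 1)))) (subst (λ d → 0ℚ ≤ d + ½) (defect-sym 1 2) defect₁₂))
               (0≤* (0≤ι (σ (suc (m ℕ.+ 2)))) defect₁₁))))
          (0≤* {ℤ.+ 1 / 80} (ℚₚ.≤ᵇ⇒≤ _) (0≤q-p near)))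
        where
        a : ℕ
        a = m ℕ.+ 4
        R N S₀ S₁ S₂ : ℚ
        R  = Σ m (inner a 1)
        N  = s (suc (a ℕ.+ 0))
        S₀ = s (suc (m ℕ.+ 0))
        S₁ = s (suc (m ℕ.+ 1))
        S₂ = s (suc (m ℕ.+ 2))
        0≤R : 0ℚ ≤ R
        0≤R = 0≤Σ-inner m 4 1 λ i i<m → below (i ℕ.+ 4) 1
          (ℕₚ.≤-trans (s≤s z≤n) (ℕₚ.m≤n+m 4 i)) (s≤s z≤n) (ℕₚ.+-monoˡ-≤ 1 (ℕₚ.m≤n+m 4 i))
          (ℕₚ.+-monoˡ-< 1 (ℕₚ.+-monoˡ-< 4 i<m))
        near : ι 80 * N + ι 80 + (ι 90 * S₀ + ι 40 * S₁ + ι 90 * S₂) ≤ ι 8 * (ι 10 * p a)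
        near = subst (_≤ ι 8 * (ι 10 * p a))
          (ι-affine (σ (suc (a ℕ.+ 0))) (σ (suc (m ℕ.+ 0))) (σ (suc (m ℕ.+ 1))) (σ (suc (m ℕ.+ 2))))
          (ℚₚ.≤-trans (ι-mono (σ-bound-b≡1 m)) (ι-G-≤ 8 a))
        expand : bracket a 1 ≡
          (R + (S₀ * defect 3 1 + (S₁ * defect 2 1 + (S₂ * defect 1 1 + (0ℚ + 0ℚ))))) + (1ℚ * (p a * ι 1 - N) + 0ℚ)
        expand = cong₂ _+_
          (trans (Σ-++ m 4 (inner a 1)) (cong (R +_) (cong₂ _+_ (inner-term m 4 0 1)
            (cong₂ _+_ (inner-term m 4 1 1) (cong₂ _+_ (inner-term m 4 2 1) (cong (_+ 0ℚ) (inner-zero m 4 3 1 refl)))))))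
          (cong (λ q → q * (p a * ι 1 - N) + 0ℚ) p-zero)
        -- The bracket is 1 plus visibly nonnegative terms. The factor 1/80 undoes the scaling of
        -- `σ-bound-b≡1`, whose summand 80 becomes the 1.
        certificate : 1ℚ + (R + (S₀ * (defect 3 1 + ℤ.+ 9 / 8) + (S₁ * (defect 2 1 + ½) + S₂ * (defect 1 1 + ℤ.+ 9 / 8)))
          + ℤ.+ 1 / 80 * (ι 8 * (ι 10 * p a) - (ι 80 * N + ι 80 + (ι 90 * S₀ + ι 40 * S₁ + ι 90 * S₂)))) ≡ bracket a 1
        certificate = trans
          (solve 9 (λ r n s₀ s₁ s₂ d₃ d₂ d₁ q →
            con 1ℚ :+ (r :+ (s₀ :* (d₃ :+ con (ℤ.+ 9 / 8)) :+ (s₁ :* (d₂ :+ con ½) :+ s₂ :* (d₁ :+ con (ℤ.+ 9 / 8))))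
              :+ con (ℤ.+ 1 / 80) :* (con (ι 8) :* (con (ι 10) :* q)
                 :- (con (ι 80) :* n :+ con (ι 80) :+ (con (ι 90) :* s₀ :+ con (ι 40) :* s₁ :+ con (ι 90) :* s₂))))
            := (r :+ (s₀ :* d₃ :+ (s₁ :* d₂ :+ (s₂ :* d₁ :+ (con 0ℚ :+ con 0ℚ))))) :+ (con 1ℚ :* (q :* con (ι 1) :- n) :+ con 0ℚ))
            refl R N S₀ S₁ S₂ (defect 3 1) (defect 2 1) (defect 1 1) (p a))
          (sym expand)

      -- With c = 2 + b, both factors of P_{c-1} (P_a - σ(a+1)) are at least 1, which gives the 1,
      -- and P_{c-2} (3 P_a - σ(a+2)) ≥ (9/8) σ(a-1) compensates σ(a-1) D(1, c).
      1≤bracket-b≥2 : ∀ m b → 2 ℕ.+ b ℕ.≤ suc m ℕ.+ 2 → NonnegativeBelow (suc m ℕ.+ 2 ℕ.+ (2 ℕ.+ b)) →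
        1ℚ ≤ bracket (suc m ℕ.+ 2) (2 ℕ.+ b)
      1≤bracket-b≥2 m b b≤a below = ≤-by certificate
        (0≤+ (0≤+ 0≤R (0≤+ 0≤R′ (0≤* (0≤ι (σ (suc (suc m ℕ.+ 0)))) 0≤d)))
          (0≤+ (0≤+ (0≤* (0≤q-p (1≤p (1 ℕ.+ b))) 0≤u) (0≤+ (0≤q-p (1≤p (1 ℕ.+ b))) 0≤u))
               (0≤+ (0≤* (0≤q-p (1≤p b)) 0≤v) (0≤+ (0≤* (0≤q-p (1≤p b)) (0≤* {ℤ.+ 9 / 8} (ℚₚ.≤ᵇ⇒≤ _) (0≤ι (σ (suc (suc m ℕ.+ 0)))))) 0≤v))))
        where
        a c : ℕ
        a = suc m ℕ.+ 2
        c = 2 ℕ.+ b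
        3≤a : 3 ℕ.≤ a
        3≤a = s≤s (ℕₚ.m≤n+m 2 m)
        R R′ N N′ S₀ : ℚ
        R  = Σ (suc m) (inner a c)
        R′ = Σ b (λ j → outer a c (2 ℕ.+ j))
        N  = s (suc (a ℕ.+ 0))
        N′ = s (suc (a ℕ.+ 1))
        S₀ = s (suc (suc m ℕ.+ 0))
        0≤R : 0ℚ ≤ R
        0≤R = 0≤Σ-inner (suc m) 2 c λ i i<m → 0≤defect-≥2 below (i ℕ.+ 2) c (ℕₚ.m≤n+m 2 i) (s≤s (s≤s z≤n))
          (ℕₚ.+-monoˡ-< c (ℕₚ.+-monoˡ-< 2 i<m))
        0≤R′ : 0ℚ ≤ R′
        -- Here k = 3 + j ≤ c ≤ a, which is where the order of the two indices enters.
        0≤R′ = 0≤Σ b λ j j<b → 0≤outer a c (2 ℕ.+ j) 3≤a (ℕₚ.<-≤-trans (s≤s (s≤s j<b)) b≤a)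
        0≤d : 0ℚ ≤ defect 1 c + ℤ.+ 9 / 8
        0≤d = defect-one below c (s≤s z≤n) (ℕₚ.+-monoˡ-< c (ℕₚ.≤-trans (s≤s (s≤s z≤n)) 3≤a))
        0≤u : 0ℚ ≤ p a - N - 1ℚ
        0≤u = subst (0ℚ ≤_)
          (solve 2 (λ q n → con (ℤ.+ 1 / 10) :* (con (ι 10) :* q :- (con (ι 10) :* n :+ con (ι 10))) := q :- n :- con 1ℚ) refl (p a) N)
          (0≤* {ℤ.+ 1 / 10} (ℚₚ.≤ᵇ⇒≤ _) (0≤q-p next))
          where
          next : ι 10 * N + ι 10 ≤ ι 10 * p a
          next = ℚₚ.≤-trans
            (ℚₚ.≤-reflexive (sym (trans (ι-+ (10 ℕ.* σ (suc (a ℕ.+ 0))) 10) (cong (_+ ι 10) (ι-* 10 (σ (suc (a ℕ.+ 0))))))))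
            (ℚₚ.≤-trans (ι-mono (σ-bound-k≡1 m)) (p-lower a))
        0≤v : 0ℚ ≤ p a * ι 3 - N′ - ℤ.+ 9 / 8 * S₀
        0≤v = subst (0ℚ ≤_)
          (solve 3 (λ q n t → con (ℤ.+ 1 / 80) :* (con (ι 24) :* (con (ι 10) :* q) :- (con (ι 80) :* n :+ con (ι 90) :* t))
            := q :* con (ι 3) :- n :- con (ℤ.+ 9 / 8) :* t) refl (p a) N′ S₀)
          (0≤* {ℤ.+ 1 / 80} (ℚₚ.≤ᵇ⇒≤ _) (0≤q-p next-two))
          where
          next-two : ι 80 * N′ + ι 90 * S₀ ≤ ι 24 * (ι 10 * p a)
          next-two = ℚₚ.≤-trans
            (ℚₚ.≤-reflexive (sym (trans (ι-+ (80 ℕ.* σ (suc (a ℕ.+ 1))) (90 ℕ.* σ (suc (suc m ℕ.+ 0))))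
              (cong₂ _+_ (ι-* 80 (σ (suc (a ℕ.+ 1)))) (ι-* 90 (σ (suc (suc m ℕ.+ 0))))))))
            (ℚₚ.≤-trans (ι-mono (σ-bound-k≡2 m)) (ι-G-≤ 24 a))
        expand : bracket a c ≡
          (R + (S₀ * defect 1 c + (0ℚ + 0ℚ))) + (p (1 ℕ.+ b) * (p a * ι 1 - N) + (p b * (p a * ι 3 - N′) + R′))
        expand = cong (_+ Σ c (outer a c))
          (trans (Σ-++ (suc m) 2 (inner a c)) (cong (R +_) (cong₂ _+_ (inner-term (suc m) 2 0 c)
            (cong (_+ 0ℚ) (inner-zero (suc m) 2 1 c refl)))))
        -- Both products are expanded by uw - t = (u-1)(w-t) + (u-1)t + (w-t), with t = 1 and t =
        -- (9/8) σ(a-1), so that each summand is nonnegative when u ≥ 1 and w ≥ t.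
        certificate : 1ℚ + (R + (R′ + S₀ * (defect 1 c + ℤ.+ 9 / 8))
          + (((p (1 ℕ.+ b) - 1ℚ) * (p a - N - 1ℚ) + ((p (1 ℕ.+ b) - 1ℚ) + (p a - N - 1ℚ)))
          + ((p b - 1ℚ) * (p a * ι 3 - N′ - ℤ.+ 9 / 8 * S₀)
             + ((p b - 1ℚ) * (ℤ.+ 9 / 8 * S₀) + (p a * ι 3 - N′ - ℤ.+ 9 / 8 * S₀))))) ≡ bracket a c
        certificate = trans
          (solve 9 (λ r r′ n n′ t d q u v →
            con 1ℚ :+ (r :+ (r′ :+ t :* (d :+ con (ℤ.+ 9 / 8)))
              :+ (((u :- con 1ℚ) :* (q :- n :- con 1ℚ) :+ ((u :- con 1ℚ) :+ (q :- n :- con 1ℚ)))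
              :+ ((v :- con 1ℚ) :* (q :* con (ι 3) :- n′ :- con (ℤ.+ 9 / 8) :* t)
                 :+ ((v :- con 1ℚ) :* (con (ℤ.+ 9 / 8) :* t) :+ (q :* con (ι 3) :- n′ :- con (ℤ.+ 9 / 8) :* t)))))
            := (r :+ (t :* d :+ (con 0ℚ :+ con 0ℚ))) :+ (u :* (q :* con (ι 1) :- n) :+ (v :* (q :* con (ι 3) :- n′) :+ r′)))
            refl R R′ N N′ S₀ (defect 1 c) (p a) (p (1 ℕ.+ b)) (p b))
          (sym expand)

      1≤bracket : ∀ a b → 0 ℕ.< b → b ℕ.≤ a → 5 ℕ.≤ a ℕ.+ b → NonnegativeBelow (a ℕ.+ b) → 1ℚ ≤ bracket a b
      1≤bracket a 0 () _ _ _
      1≤bracket a 1 _ _ 5≤a+1 below =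
        subst (λ k → 1ℚ ≤ bracket k 1) a≡ (1≤bracket-b≡1 (a ∸ 4) (subst (λ k → NonnegativeBelow (k ℕ.+ 1)) (sym a≡) below))
        where
        a≡ : a ∸ 4 ℕ.+ 4 ≡ a
        a≡ = ℕₚ.m∸n+n≡m (ℕₚ.+-cancelʳ-≤ 1 4 a 5≤a+1)
      1≤bracket 0 (suc (suc _)) _ () _ _
      1≤bracket 1 (suc (suc _)) _ (s≤s ()) _ _
      1≤bracket 2 (suc (suc zero)) _ _ (s≤s (s≤s (s≤s (s≤s ())))) _
      1≤bracket 2 (suc (suc (suc _))) _ (s≤s (s≤s ())) _ _
      1≤bracket a@(suc (suc (suc m))) (suc (suc b)) _ b≤a _ below =
        subst (λ k → 1ℚ ≤ bracket k (2 ℕ.+ b)) a≡ (1≤bracket-b≥2 m b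
          (subst (2 ℕ.+ b ℕ.≤_) (sym a≡) b≤a)
          (subst (λ k → NonnegativeBelow (k ℕ.+ (2 ℕ.+ b))) (sym a≡) below))
        where
        a≡ : suc m ℕ.+ 2 ≡ a
        a≡ = ℕₚ.+-comm (suc m) 2

      1≤x : 1ℚ ≤ x
      1≤x = ℚₚ.≤-trans (ℚₚ.≤ᵇ⇒≤ _) 9/5≤x

      defect-step : ∀ a b → 0 ℕ.< b → b ℕ.≤ a → 5 ℕ.≤ a ℕ.+ b → NonnegativeBelow (a ℕ.+ b) →
        1ℚ ≤ ι (a ℕ.+ b) * defect a b
      defect-step a b 0<b b≤a 5≤a+b below = begin
        1ℚ                          ≤⟨ 1≤x ⟩
        x                           ≡⟨ ℚₚ.*-identityʳ x ⟨
        x * 1ℚ                      ≤⟨ *-monoʳ 0≤x (1≤bracket a b 0<b b≤a 5≤a+b below) ⟩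
        x * bracket a b             ≡⟨ defect-recurrence a b ⟨
        ι (a ℕ.+ b) * defect a b    ∎
        where open ℚₚ.≤-Reasoning

      defect-lower : ∀ n a b → 0 ℕ.< a → 0 ℕ.< b → 5 ℕ.≤ a ℕ.+ b → a ℕ.+ b ≡ n → 1ℚ ≤ ι n * defect a b
      defect-lower = <-rec _ λ { _ ih a b 0<a 0<b 5≤a+b refl → wlog a b 0<a 0<b 5≤a+b ih }
        where
        wlog : ∀ a b → 0 ℕ.< a → 0 ℕ.< b → 5 ℕ.≤ a ℕ.+ b →
          (∀ {m} → m ℕ.< a ℕ.+ b → ∀ c d → 0 ℕ.< c → 0 ℕ.< d → 5 ℕ.≤ c ℕ.+ d → c ℕ.+ d ≡ m → 1ℚ ≤ ι m * defect c d) →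
          1ℚ ≤ ι (a ℕ.+ b) * defect a b
        wlog a b 0<a 0<b 5≤a+b ih with ℕₚ.≤-total b a
        ... | inj₁ b≤a = defect-step a b 0<b b≤a 5≤a+b below
          where
          below : NonnegativeBelow (a ℕ.+ b)
          below c d 0<c 0<d 5≤c+d c+d<n = 0≤-cancel (c ℕ.+ d) (ih c+d<n c d 0<c 0<d 5≤c+d refl)
        ... | inj₂ a≤b = subst₂ (λ n d → 1ℚ ≤ ι n * d) (ℕₚ.+-comm b a) (defect-sym b a)
          (defect-step b a 0<a a≤b (subst (5 ℕ.≤_) (ℕₚ.+-comm a b) 5≤a+b) below)
          where
          below : NonnegativeBelow (b ℕ.+ a)
          below c d 0<c 0<d 5≤c+d c+d<n = 0≤-cancel (c ℕ.+ d)
            (ih (subst (c ℕ.+ d ℕ.<_) (ℕₚ.+-comm b a) c+d<n) c d 0<c 0<d 5≤c+d refl)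

  -- Transfer to the Cauchy reals

  1/n*n≡1 : ∀ n → (ℤ.+ 1 / suc n) * ι (suc n) ≡ 1ℚ
  1/n*n≡1 n = trans (cong (_* ι (suc n)) (ℚₚ.normalize-coprime (1-coprimeTo (suc n)))) (ℚₚ.*-inverseˡ (ι (suc n)))

  1/n≤ : ∀ n {q} .{{_ : ℕ.NonZero n}} → 1ℚ ≤ ι n * q → ℤ.+ 1 / n ≤ q
  1/n≤ (suc n) {q} 1≤nq = ℚₚ.*-cancelˡ-≤-pos (ι (suc n)) (subst (_≤ ι (suc n) * q)
    (sym (trans (ℚₚ.*-comm (ι (suc n)) (ℤ.+ 1 / suc n)) (1/n*n≡1 n))) 1≤nq)

  P-isDArcais : ∀ x i → IsDArcais (seq x i) (λ n → seq (P n x) i)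
  P-isDArcais x i = record { p-zero = refl ; p-suc = λ n → begin
      ι (suc n) * seq (P (suc n) x) i
        ≡⟨ cong (λ q → ι (suc n) * seq q i) (P-suc n x) ⟩
      ι (suc n) * ((ℤ.+ 1 / suc n) * seq x i * seq (∑ (terms n)) i)
        ≡⟨ cong (λ q → ι (suc n) * ((ℤ.+ 1 / suc n) * seq x i * q)) (seq-∑ {F = terms n} {summand n} (λ k →
             cong (_* seq (P (n ∸ toℕ k) x) i) (/1≡ι (σ (suc (toℕ k)))))) ⟩
      ι (suc n) * ((ℤ.+ 1 / suc n) * seq x i * S n)
        ≡⟨ solve 4 (λ m r x c → m :* (r :* x :* c) := (r :* m) :* (x :* c)) refl (ι (suc n)) (ℤ.+ 1 / suc n) (seq x i) (S n) ⟩
      ((ℤ.+ 1 / suc n) * ι (suc n)) * (seq x i * S n)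
        ≡⟨ cong (_* (seq x i * S n)) (1/n*n≡1 n) ⟩
      1ℚ * (seq x i * S n)
        ≡⟨ ℚₚ.*-identityˡ (seq x i * S n) ⟩
      seq x i * S n ∎ }
    where
    open ≡-Reasoning
    terms : ∀ n → Fin (suc n) → ℝ
    terms n k = fromℚ (ℤ.+ σ (suc (toℕ k)) / 1) *ℝ P (suc n ∸ suc (toℕ k)) x
    summand : ℕ → ℕ → ℚ
    summand n j = s (suc j) * seq (P (n ∸ j) x) i
    S : ℕ → ℚ
    S n = Σ (suc n) (summand n)

  -- The gap 1/(a+b) is the same for every term. The index `N` from the hypothesis serves again,
  -- since from there on all terms of `x` are at least 9/5.
  P-submultiplicative : ∀ a b → 0 ℕ.< a → 0 ℕ.< b → 5 ℕ.≤ a ℕ.+ b → ∀ x → fromℚ (ℤ.+ 18 / 10) <ℝ x →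
    P (a ℕ.+ b) x <ℝ P a x *ℝ P b x
  P-submultiplicative a b 0<a 0<b 5≤a+b x (ε , 0<ε , N , x>) =
    gap , ℚₚ.positive⁻¹ gap {{ℚₚ.normalize-pos 1 (a ℕ.+ b)}} , N , λ i N≤i →
      subst (seq (P (a ℕ.+ b) x) i + gap ≤_)
        (solve 2 (λ q r → q :+ (r :- q) := r) refl (seq (P (a ℕ.+ b) x) i) (seq (P a x) i * seq (P b x) i))
        (ℚₚ.+-monoʳ-≤ (seq (P (a ℕ.+ b) x) i) (1/n≤ (a ℕ.+ b)
          (defect-lower (P-isDArcais x i) (ℚₚ.≤-trans (p≤p+r (ℚₚ.<⇒≤ 0<ε)) (x> i N≤i)) (a ℕ.+ b) a b 0<a 0<b 5≤a+b refl)))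
    where
    instance
      a+b≢0 : ℕ.NonZero (a ℕ.+ b)
      a+b≢0 = ℕ.>-nonZero (ℕₚ.≤-trans (s≤s z≤n) 5≤a+b)
    gap : ℚ
    gap = ℤ.+ 1 / (a ℕ.+ b)

open import Data.Nat.Base using (ℕ; _+_; _>_; NonZero; >-nonZero⁻¹)
open import Data.Integer.Base using (+_)
open import Data.Rational.Base using (_/_)

theorem1p4 :
    (a b : ℕ) .{{_ : NonZero a}} .{{_ : NonZero b}} → a + b > 4 →
    (x : ℝ) → x >ℝ fromℚ (+ 18 / 10) →
    P a x *ℝ P b x >ℝ P (a + b) x
theorem1p4 a b a+b>4 x x>9/5 =
  Analysis.P-submultiplicative a b (>-nonZero⁻¹ a) (>-nonZero⁻¹ b) a+b>4 x x>9/5
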